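{- Let $w\in B_n$ avoid the patterns $3412$ and $4231$, and let the zig-zag network $F_w$ have path matrix $A$. Then for every linear functional $\theta:\mathbb C[B_n]\to\mathbb C$, $$\theta(C'_w(1))=\mathrm{Imm}^{B_n}_\theta(A).$$
   Context: $[\bar n,n]=\{ -n,\dots,-1,1,\dots,n\}$, $\bar a=-a$, $[h,l]=\{h,\dots,l\}\setminus\{0\}$. $B_n$ is the group of permutations $w$ of $[\bar n,n]$ with $w(\bar i)=\overline{w(i)}$ (Coxeter group of type $B_n=C_n$, Bruhat order $\le_{B_n}$); $w_i=w(i)$; $w$ avoids $3412,4231$ if $w_{\bar n}\cdots w_{\bar1}w_1\cdots w_n$ has no subsequence order-isomorphic to them. For such $w$, $C'_w(1)$ is the Kazhdan–Lusztig basis element of the Hecke algebra of $B_n$ specialized at $q=1$, equal to $\sum_{v\le_{B_n}w}v$. For a $2n\times2n$ matrix $A=(a_{i,j})_{i,j\in[\bar n,n]}$, $\mathrm{Imm}^{B_n}_\theta(A)=\sum_{v\in B_n}\theta(v)\,a_{\bar n,v_{\bar n}}\cdots a_{\bar1,v_{\bar1}}a_{1,v_1}\cdots a_{n,v_n}$. Networks: a type-A planar network on $[h,l]$ is a directed planar acyclic multigraph in a disc with boundary vertices labelled clockwise source $h,\dots,$ source $l$, sink $l,\dots,$ sink $h$; edges may carry positive integer multiplicities; sources indegree 0, outdegree 1; sinks indegree 1, outdegree 0. For $[a,b]\subseteq[h,l]$, $F_{[a,b]}$ has an edge source $i\to$ sink $i$ for $i\notin[a,b]$ and one interior vertex $z$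 with edges source $i\to z\to$ sink $i$ for $i\in[a,b]$ (none if $a=b$). $E\bullet F$: merge, for each $i$, the edge into sink $i$ of $E$ with the edge out of source $i$ of $F$, then replace each set of $m>1$ parallel edges by one edge of multiplicity $m$. Intervals $[c_1,d_1],\dots,[c_t,d_t]$ satisfy the zig-zag conditions if distinct, pairwise non-nesting, and for $i<j<k$ with $[c_i,d_i]\cap[c_j,d_j]\ne\emptyset\ne[c_j,d_j]\cap[c_k,d_k]$ one has $c_i<c_j<c_k$ or $c_i>c_j>c_k$; zig-zag networks are $F_{[c_1,d_1]}\bullet\cdots\bullet F_{[c_t,d_t]}$ with such intervals (or trivial). A path family of type $u$ is $(\pi_h,\dots,\pi_l)$ with $\pi_i$ from source $i$ to sink $u(i)$, covering $F$ if every edge lies on some path; for a zig-zag network $F$ the covering types have a unique maximal-length element $w(F)$, and $F\mapsto w(F)$ is a bijection onto permutations avoiding $3412,4231$, with inverse $w\mapsto F_w$. The path matrix of a network on $[\bar n,n]$ is $A=(a_{i,j})$ with $a_{i,j}$ the number of directed paths from source $i$ to sink $j$ (edge multiplicities ignored). -}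

module Defs where

open import Level using (Level)
open import Data.Bool using (Bool; true; false; _∧_; _∨_; not; if_then_else_; T)
open import Data.Nat as ℕ using (ℕ; zero; suc; _<ᵇ_; _≤ᵇ_)
open import Data.Fin as Fin using (Fin; toℕ; opposite; _↑ʳ_; inject₁)
open import Data.Fin.Properties using (_≟_)
open import Data.Vec as Vec using (Vec; lookup; tabulate)
open import Data.List as List using (List; []; _∷_; _++_; [_]; map; allFin; concatMap; length; filterᵇ; reverse)
open import Data.Bool.ListAction using (all; any)
open import Data.List.Membership.Propositional using (_∈_)
open import Data.Product using (Σ; ∃; _×_; _,_)
open import Data.Sum using (_⊎_)
open import Relation.Nullary using (Dec; ¬_)
open import Relation.Nullary.Decidable using (⌊_⌋)
open import Relation.Binary.PropositionalEquality using (_≡_)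
open import Relation.Binary.Construct.Closure.ReflexiveTransitive using (Star)
open import Algebra.Bundles using (CommutativeRing)

-- Conventions.
-- The index set [n̄,n] = {-n,…,-1,1,…,n} is encoded order-preservingly
-- as Fin (n + n):  label -j ↦ index n - j,  label j ↦ index n - 1 + j.
-- Negation (bar) is then  Fin.opposite  (k ↦ 2n-1-k).

M : ℕ → ℕ
M n = n ℕ.+ n

Idx : ℕ → Set
Idx n = Fin (M n)

-- positive label i+1 and negative label -(i+1), for i : Fin n
pos : ∀ {n} → Fin n → Idx n
pos {n} i = n ↑ʳ i

neg : ∀ {n} → Fin n → Idx n
neg i = opposite (pos i)

_==_ : ∀ {m} → Fin m → Fin m → Bool
a == b = ⌊ a ≟ b ⌋

_<F_ : ∀ {m} → Fin m → Fin m → Bool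
a <F b = toℕ a <ᵇ toℕ b

_≤F_ : ∀ {m} → Fin m → Fin m → Bool
a ≤F b = toℕ a ≤ᵇ toℕ b

-- Permutations of [n̄,n] in one-line notation: the vector
-- (w(n̄), …, w(1̄), w(1), …, w(n)).

record Elt (n : ℕ) : Set where
  constructor mkE
  field
    oneLine : Vec (Idx n) (M n)

_⟨_⟩ : ∀ {n} → Elt n → Idx n → Idx n
w ⟨ k ⟩ = lookup (Elt.oneLine w) k

_·_ : ∀ {n} → Elt n → Elt n → Elt n
v · w = mkE (tabulate (λ k → v ⟨ (w ⟨ k ⟩) ⟩))

idE : ∀ {n} → Elt n
idE = mkE (tabulate (λ k → k))

isPermᵇ : ∀ {n} → Elt n → Bool
isPermᵇ {n} v = all (λ i → all (λ j → not ((v ⟨ i ⟩) == (v ⟨ j ⟩)) ∨ (i == j))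
                                (allFin (M n))) (allFin (M n))

isSignedᵇ : ∀ {n} → Elt n → Bool
isSignedᵇ {n} v = all (λ k → (v ⟨ opposite k ⟩) == opposite (v ⟨ k ⟩)) (allFin (M n))

inBᵇ : ∀ {n} → Elt n → Bool
inBᵇ v = isPermᵇ v ∧ isSignedᵇ v

allVecs : ∀ {A : Set} → List A → (k : ℕ) → List (Vec A k)
allVecs xs zero = [ Vec.[] ]
allVecs xs (suc k) = concatMap (λ a → map (a Vec.∷_) (allVecs xs k)) xs

Bn : (n : ℕ) → List (Elt n)
Bn n = filterᵇ inBᵇ (map mkE (allVecs (allFin (M n)) (M n)))

-- Coxeter structure of B_n: generators s_0 = (1 1̄),
-- s_i = (i i+1)(ī ī+1) for 1 ≤ i ≤ n-1 (generator index i : Fin n).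

swapE : ∀ {n} → Idx n → Idx n → Elt n
swapE a b = mkE (tabulate (λ k → if k == a then b else (if k == b then a else k)))

gen : ∀ {n} → Fin n → Elt n
gen {suc n} Fin.zero = swapE (pos Fin.zero) (neg Fin.zero)
gen {suc n} (Fin.suc i) =
  swapE (pos (inject₁ i)) (pos (Fin.suc i)) · swapE (neg (inject₁ i)) (neg (Fin.suc i))

prodW : ∀ {n} → List (Fin n) → Elt n
prodW [] = idE
prodW (i ∷ is) = gen i · prodW is

HasLength : ∀ {n} → Elt n → ℕ → Set
HasLength {n} w k =
  (∃ λ (ws : List (Fin n)) → length ws ≡ k × prodW ws ≡ w) ×
  (∀ (ws : List (Fin n)) → prodW ws ≡ w → k ℕ.≤ length ws)

-- reflections: conjugates x s x⁻¹ of simple generators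
Reflection : ∀ {n} → Elt n → Set
Reflection {n} t = ∃ λ (ws : List (Fin n)) → ∃ λ (i : Fin n) → t ≡ prodW (ws ++ i ∷ reverse ws)

BruhatStep : ∀ {n} → Elt n → Elt n → Set
BruhatStep u w = ∃ λ t → Reflection t × (u · t) ≡ w ×
  (∃ λ a → ∃ λ b → HasLength u a × HasLength w b × a ℕ.< b)

_≤B_ : ∀ {n} → Elt n → Elt n → Set
_≤B_ = Star BruhatStep

Contains3412 : ∀ {n} → Elt n → Set
Contains3412 w = ∃ λ i → ∃ λ j → ∃ λ k → ∃ λ l →
  i Fin.< j × j Fin.< k × k Fin.< l ×
  (w ⟨ k ⟩) Fin.< (w ⟨ l ⟩) × (w ⟨ l ⟩) Fin.< (w ⟨ i ⟩) × (w ⟨ i ⟩) Fin.< (w ⟨ j ⟩)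

Contains4231 : ∀ {n} → Elt n → Set
Contains4231 w = ∃ λ i → ∃ λ j → ∃ λ k → ∃ λ l →
  i Fin.< j × j Fin.< k × k Fin.< l ×
  (w ⟨ l ⟩) Fin.< (w ⟨ j ⟩) × (w ⟨ j ⟩) Fin.< (w ⟨ k ⟩) × (w ⟨ k ⟩) Fin.< (w ⟨ i ⟩)

record Intervals (n t : ℕ) : Set where
  field
    c d : Fin t → Idx n
    c≤d : ∀ k → c k Fin.≤ d k

open Intervals public

Overlap : ∀ {n t} → Intervals n t → Fin t → Fin t → Set
Overlap I a b = c I a Fin.≤ d I b × c I b Fin.≤ d I a

ZigZag : ∀ {n t} → Intervals n t → Set
ZigZag {n} {t} I =
  (∀ a b → ¬ a ≡ b → ¬ (c I a ≡ c I b × d I a ≡ d I b)) ×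
  (∀ a b → ¬ a ≡ b → ¬ (c I b Fin.≤ c I a × d I a Fin.≤ d I b)) ×
  (∀ i j k → i Fin.< j → j Fin.< k → Overlap I i j → Overlap I j k →
     (c I i Fin.< c I j × c I j Fin.< c I k) ⊎ (c I k Fin.< c I j × c I j Fin.< c I i))

-- Vertices of F_{[c_1,d_1]} • ⋯ • F_{[c_t,d_t]}: sources, the interior
-- vertex z_k of each nontrivial factor, sinks.
data Vtx (n t : ℕ) : Set where
  src : Idx n → Vtx n t
  mid : Fin t → Vtx n t
  snk : Idx n → Vtx n t

module Network {n t : ℕ} (I : Intervals n t) where

  stages : List (Fin t)
  stages = allFin t

  positions : List (Idx n)
  positions = allFin (M n)

  -- factor k is nontrivial and position i passes through its vertex z_k
  cut : Fin t → Idx n → Bool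
  cut k i = (c I k <F d I k) ∧ (c I k ≤F i) ∧ (i ≤F d I k)

  -- (merged, multiplicities ignored) edge relation of the composite network:
  -- the wire at position i runs between consecutive vertices it meets.
  edge : Vtx n t → Vtx n t → Bool
  edge (src i) (mid k) = cut k i ∧ all (λ k' → not ((k' <F k) ∧ cut k' i)) stages
  edge (src i) (snk j) = (i == j) ∧ all (λ k → not (cut k i)) stages
  edge (mid a) (mid b) = (a <F b) ∧
    any (λ i → cut a i ∧ cut b i ∧
               all (λ k → not ((a <F k) ∧ (k <F b) ∧ cut k i)) stages) positions
  edge (mid a) (snk j) = cut a j ∧ all (λ k → not ((a <F k) ∧ cut k j)) stages
  edge _ _ = false

  -- a path from v to sink j, given by the interior vertices it visits
  valid : Vtx n t → List (Fin t) → Idx n → Bool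
  valid v [] j = edge v (snk j)
  valid v (k ∷ ks) j = edge v (mid k) ∧ valid (mid k) ks j

  vseq : Vtx n t → List (Fin t) → Idx n → List (Vtx n t)
  vseq v ks j = v ∷ map mid ks ++ [ snk j ]

  consecutive : ∀ {A : Set} → List A → List (A × A)
  consecutive [] = []
  consecutive (x ∷ []) = []
  consecutive (x ∷ y ∷ xs) = (x , y) ∷ consecutive (y ∷ xs)

  sublists : ∀ {A : Set} → List A → List (List A)
  sublists [] = [ [] ]
  sublists (x ∷ xs) = map (x ∷_) (sublists xs) ++ sublists xs

  -- path matrix: a_{i,j} = number of directed paths source i → sink j
  -- (paths visit interior vertices in increasing order, so each path is
  -- exactly one sublist of the list of stages)
  pathMatrix : Idx n → Idx n → ℕ
  pathMatrix i j = length (filterᵇ (λ ks → valid (src i) ks j) (sublists stages))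

  CoveringFamily : Elt n → Set
  CoveringFamily u =
    Σ (Idx n → List (Fin t)) λ π →
      (∀ i → T (valid (src i) (π i) ((u ⟨ i ⟩)))) ×
      (∀ a b → T (edge a b) →
         ∃ λ i → (a , b) ∈ consecutive (vseq (src i) (π i) ((u ⟨ i ⟩))))

  IsCoveringType : Elt n → Set
  IsCoveringType u = T (isPermᵇ u) × CoveringFamily u

invA : ∀ {n} → Elt n → ℕ
invA {n} u = length (filterᵇ (λ p → pairInv p)
  (concatMap (λ i → map (λ j → (i , j)) (allFin (M n))) (allFin (M n))))
  where
  pairInv : Idx n × Idx n → Bool
  pairInv (i , j) = (i <F j) ∧ ((u ⟨ j ⟩) <F (u ⟨ i ⟩))

-- w = w(F): the (unique) maximal-length type of a covering path family
IsMaxCoveringType : ∀ {n t} → Intervals n t → Elt n → Set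
IsMaxCoveringType {n} I w =
  IsCoveringType w × (∀ u → IsCoveringType u → invA u ℕ.≤ invA w)
  where open Network I

module RingOps {c ℓ : Level} (R : CommutativeRing c ℓ) where
  open CommutativeRing R

  sumR : List Carrier → Carrier
  sumR = List.foldr _+_ 0#

  fromℕ : ℕ → Carrier
  fromℕ zero = 0#
  fromℕ (suc k) = 1# + fromℕ k

  prodR : ∀ {m} → (Fin m → Carrier) → Carrier
  prodR f = List.foldr _*_ 1# (map f (allFin _))

  -- θ(C'_w(1)) = Σ_{v ∈ B_n, v ≤ w} θ(v)
  thetaC' : ∀ {n} → (θ : Elt n → Carrier) → (w : Elt n) →
            (∀ v → Dec (v ≤B w)) → Carrier
  thetaC' {n} θ w dec = sumR (map (λ v → if ⌊ dec v ⌋ then θ v else 0#) (Bn n))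

  immB : ∀ {n} → (θ : Elt n → Carrier) → (Idx n → Idx n → ℕ) → Carrier
  immB {n} θ A = sumR (map (λ v → θ v * prodR (λ k → fromℕ (A k ((v ⟨ k ⟩))))) (Bn n))

{-# OPTIONS --safe #-}

-- Only the coefficient of each v ∈ B_n matters: v ≤ w must hold exactly when every source k is joined to sink v k,
-- and then by a single path.
--
-- Sorted by left end point, the interior vertices of a zig-zag network form a line along which every path moves
-- monotonically, so two vertices are joined by at most one path. Two paths whose ends are inverted cross, hence the
-- relation "k reaches v k" survives each step down from w in the Bruhat order. Conversely, since w has the most
-- inversions among the covering types, covering paths that meet are inverted; this confines every reachable
-- pair (i , j) to the hull of w, i.e. w takes a value ≥ j weakly before i and a value ≤ j weakly after i. When w
-- avoids 3412 and 4231, a pigeonhole argument at the first position where v ∈ hull differs from w exhibits a pair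
-- that can be exchanged upwards without leaving the hull; the hull is stable under negation, so this exchange can be
-- performed by a reflection of B_n.
--
-- Lengths in B_n are only compared through the exchange property: a word that inverts the pair x < y
-- can be shortened by one letter at the cost of the reflection of that pair.
module Submission where

open import Defs
open import Level using (Level)
open import Algebra.Bundles using (CommutativeRing)
open import Data.Bool using (if_then_else_; Bool; T; _∧_; not; _∨_)
open import Data.Bool.ListAction using (all)
open import Data.Bool.Properties using (T-∧; T-∨; T?)
open import Data.Empty using (⊥; ⊥-elim)
open import Data.Fin as Fin using (Fin; toℕ; opposite; inject₁; fromℕ<)
open import Data.Fin.Induction using (<-wellFounded; >-wellFounded)
open import Data.Fin.Properties using (_≟_; _<?_; _≤?_; <-cmp; any?; toℕ-injective; toℕ-fromℕ<; toℕ<n; toℕ-↑ʳ; toℕ-inject₁; opposite-prop; opposite-involutive)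
open import Data.List using (List; []; _∷_; length; map; filter; allFin; _++_; reverse; [_]; filterᵇ; concatMap; cartesianProduct; foldr)
open import Data.List.Membership.Propositional using (_∈_)
open import Data.List.Membership.Propositional.Properties using (∈-∃++; ∈-map⁺; ∈-map⁻; ∈-filter⁺; ∈-filter⁻; ∈-allFin; ∈-++⁺ˡ; ∈-++⁺ʳ; ∈-++⁻; ∈-cartesianProduct⁺)
open import Data.List.Properties using (length-map; length-++-sucʳ; unfold-reverse; reverse-involutive; ++-assoc; ∷-injectiveʳ)
open import Data.List.Relation.Unary.All as All using (All; []; _∷_)
import Data.List.Relation.Unary.All.Properties as Allₚ
open import Data.List.Relation.Unary.AllPairs using ([]; _∷_; AllPairs)
import Data.List.Relation.Unary.AllPairs.Properties as AllPairsₚ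
open import Data.List.Relation.Unary.Any as Any using (here; there; satisfied)
import Data.List.Relation.Unary.Any.Properties as Anyₚ
open import Data.List.Relation.Unary.Unique.Propositional using (Unique)
import Data.List.Relation.Unary.Unique.Propositional.Properties as Uniqueₚ
open import Data.Nat as ℕ using (ℕ; zero; suc; z≤n; s≤s; _∸_)
open import Data.Nat.Properties as ℕₚ using (≤-refl; ≤-trans; <-trans; <-≤-trans; ≤-<-trans; <⇒≤; <-irrefl; ≮⇒≥; ≰⇒>; ≤∧≢⇒<; module ≤-Reasoning; ≤-antisym; ≤-reflexive; n≤1+n; m≤m+n; suc-injective; +-suc; m+n∸n≡m; ∸-monoʳ-≤; ∸-monoʳ-<; +-cancelˡ-≡; +-identityʳ; m+[n∸m]≡n; <ᵇ⇒<; <⇒<ᵇ; ≤-total; <-asym; ≤ᵇ⇒≤; ≤⇒≤ᵇ; n<1+n; m≤n⇒m<n∨m≡n; m≤n⇒m≤1+n)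
open import Data.Product using (∃; _×_; _,_; proj₁; proj₂)
open import Data.Sum using (_⊎_; inj₁; inj₂)
open import Data.Vec using (Vec; []; _∷_; lookup; tabulate)
open import Data.Vec.Properties using (lookup∘tabulate; tabulate∘lookup; tabulate-cong; ≡-dec)
open import Data.Vec.Relation.Binary.Lex.Strict as Lex using (Lex-<; this; next)
open import Function using (_∘_; id; flip; Equivalence)
open import Function.Definitions using (Injective)
open import Induction.WellFounded using (Acc; acc; WellFounded)
open import Relation.Binary.Construct.Closure.ReflexiveTransitive using (ε; _◅_)
open import Relation.Binary.Definitions using (tri<; tri≈; tri>)
open import Relation.Binary.PropositionalEquality using (_≡_; _≢_; refl; sym; trans; cong; subst; cong₂; subst₂; module ≡-Reasoning)
open import Relation.Nullary using (¬_; Dec; yes; no)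
open import Relation.Nullary.Decidable using (_×-dec_; ¬?; map′; toWitness; fromWitness; ⌊_⌋)
open import Relation.Unary using (Decidable)

-- For a signed permutation `v`, three conditions are tied into a cycle of implications: `v` lies
-- below `w`, every entry of `v` is reachable in the network, every entry of `v` lies in the hull of
-- `w`. The hull is the bridge because it speaks of `w` alone: pattern avoidance can act on it,
-- whereas reachability is only seen to survive exchanges that go down. Two mismatches between types
-- A and B shape the rest. The network and its maximal covering type are type-A data and carry no
-- symmetry under negation; the symmetry has to come from `w` being signed. Moreover a reflection of
-- type B moves up to four positions, so its effect on length is laborious to compute. Termination
-- is therefore measured by the lexicographic order of one-line notation, which is decided at the
-- least moved position, and the strict growth of length is supplied separately by the exchange
-- property.

-- Finite sets and the pigeonhole principle

unique-⊆⇒length≤ : ∀ {A : Set} {xs ys : List A} → Unique xs →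
                   (∀ {x} → x ∈ xs → x ∈ ys) → length xs ℕ.≤ length ys
unique-⊆⇒length≤ {xs = []} _ _ = z≤n
unique-⊆⇒length≤ {xs = x ∷ xs} (x∉xs ∷ uxs) sub with ∈-∃++ (sub (here refl))
... | ys₁ , ys₂ , refl = begin
  suc (length xs)            ≤⟨ s≤s (unique-⊆⇒length≤ uxs sub′) ⟩
  suc (length (ys₁ ++ ys₂))  ≡⟨ sym (length-++-sucʳ ys₁ x ys₂) ⟩
  length (ys₁ ++ x ∷ ys₂)    ∎
  where
  open ≤-Reasoning
  sub′ : ∀ {z} → z ∈ xs → z ∈ ys₁ ++ ys₂
  sub′ z∈ with ∈-++⁻ ys₁ (sub (there z∈))
  ... | inj₁ p = ∈-++⁺ˡ p
  ... | inj₂ (here refl) = ⊥-elim (All.lookup x∉xs z∈ refl)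
  ... | inj₂ (there p) = ∈-++⁺ʳ ys₁ p

module _ {N : ℕ} where

  least : ∀ {P : Fin N → Set} → Decidable P → ∀ {x} → P x →
          ∃ λ y → P y × y Fin.≤ x × (∀ z → z Fin.< y → ¬ P z)
  least {P} P? {x} = go (<-wellFounded x)
    where
    go : ∀ {x} → Acc Fin._<_ x → P x → ∃ λ y → P y × y Fin.≤ x × (∀ z → z Fin.< y → ¬ P z)
    go {x} (acc rs) px with any? (λ z → (z <? x) ×-dec P? z)
    ... | no ¬p = x , px , ≤-refl , λ z z<x pz → ¬p (z , z<x , pz)
    ... | yes (z , z<x , pz) with go (rs z<x) pz
    ...   | y , py , y≤z , min = y , py , ≤-trans y≤z (<⇒≤ z<x) , min

  greatest : ∀ {P : Fin N → Set} → Decidable P → ∀ {x} → P x →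
             ∃ λ y → P y × x Fin.≤ y × (∀ z → y Fin.< z → ¬ P z)
  greatest {P} P? {x} = go (>-wellFounded x)
    where
    go : ∀ {x} → Acc Fin._>_ x → P x → ∃ λ y → P y × x Fin.≤ y × (∀ z → y Fin.< z → ¬ P z)
    go {x} (acc rs) px with any? (λ z → (x <? z) ×-dec P? z)
    ... | no ¬p = x , px , ≤-refl , λ z x<z pz → ¬p (z , x<z , pz)
    ... | yes (z , x<z , pz) with go (rs x<z) pz
    ...   | y , py , z≤y , max = y , py , ≤-trans (<⇒≤ x<z) z≤y , max

  -- A missed `y` in `P`, put in front of the images of the elements of `P`, would give a
  -- repetition-free list inside `P` with one element too many.
  injective-closed⇒onto : ∀ {f : Fin N → Fin N} → Injective _≡_ _≡_ f →
    ∀ {P : Fin N → Set} → Decidable P → (∀ x → P x → P (f x)) →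
    ∀ y → P y → ∃ λ x → P x × f x ≡ y
  injective-closed⇒onto {f} f-inj {P} P? closed y py with any? (λ x → P? x ×-dec (f x ≟ y))
  ... | yes hit = hit
  ... | no miss = ⊥-elim (<-irrefl refl (subst (ℕ._< length xs) (length-map f xs) too-long))
    where
    xs : List (Fin N)
    xs = filter P? (allFin N)
    image-in : ∀ {z} → z ∈ map f xs → ∃ λ x → P x × f x ≡ z
    image-in z∈ with ∈-map⁻ f z∈
    ... | x , x∈ , refl = x , proj₂ (∈-filter⁻ P? {xs = allFin N} x∈) , refl
    sub : ∀ {z} → z ∈ y ∷ map f xs → z ∈ xs
    sub (here refl) = ∈-filter⁺ P? (∈-allFin y) py
    sub (there z∈) with image-in z∈
    ... | x , px , refl = ∈-filter⁺ P? (∈-allFin (f x)) (closed x px)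
    fresh : All (y ≢_) (map f xs)
    fresh = All.tabulate λ { z∈ refl → miss (image-in z∈) }
    too-long : length (map f xs) ℕ.< length xs
    too-long = unique-⊆⇒length≤
      (fresh ∷ Uniqueₚ.map⁺ f-inj (Uniqueₚ.filter⁺ P? (Uniqueₚ.allFin⁺ N))) sub

  injective⇒onto : ∀ {f : Fin N → Fin N} → Injective _≡_ _≡_ f → ∀ y → ∃ λ x → f x ≡ y
  injective⇒onto f-inj y with injective-closed⇒onto f-inj {P = λ z → z ≡ z} (λ z → yes refl)
      (λ _ _ → refl) y refl
  ... | x , _ , eq = x , eq

  module _ {v w : Fin N → Fin N} (v-inj : Injective _≡_ _≡_ v) (w-inj : Injective _≡_ _≡_ w) where

    -- If the injection that sends `x` to the position where `w` has the value `v x` kept `P`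
    -- stable, it would map `P` onto itself and hit `p`.
    escape : ∀ {P : Fin N → Set} → Decidable P → ∀ {p} → P p → (∀ x → P x → v x ≢ w p) →
             ∃ λ x → ∃ λ q → P x × ¬ P q × w q ≡ v x
    escape {P} P? {p} pp miss with any? (λ x → P? x ×-dec ¬? (P? (f x)))
      where
      f : Fin N → Fin N
      f x = proj₁ (injective⇒onto w-inj (v x))
    ... | yes (x , px , ¬pf) = x , _ , px , ¬pf , proj₂ (injective⇒onto w-inj (v x))
    ... | no closed with injective-closed⇒onto f-inj P? (λ x px → stable x px (P? (f x))) p pp
      where
      f : Fin N → Fin N
      f x = proj₁ (injective⇒onto w-inj (v x))
      wf≡v : ∀ x → w (f x) ≡ v x
      wf≡v x = proj₂ (injective⇒onto w-inj (v x))
      f-inj : Injective _≡_ _≡_ f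
      f-inj {x} {y} eq = v-inj (trans (sym (wf≡v x)) (trans (cong w eq) (wf≡v y)))
      stable : ∀ x → P x → Dec (P (f x)) → P (f x)
      stable x px (yes p) = p
      stable x px (no ¬p) = ⊥-elim (closed (x , px , ¬p))
    ... | x , px , fx≡p = ⊥-elim (miss x px (trans (sym (proj₂ (injective⇒onto w-inj (v x)))) (cong w fx≡p)))

-- The hull of a permutation avoiding 3412 and 4231

module Hull {N : ℕ} {w : Fin N → Fin N} (w-inj : Injective _≡_ _≡_ w)
  (no3412 : ∀ {i j k l} → i Fin.< j → j Fin.< k → k Fin.< l →
            w k Fin.< w l → w l Fin.< w i → w i Fin.< w j → ⊥)
  (no4231 : ∀ {i j k l} → i Fin.< j → j Fin.< k → k Fin.< l →
            w l Fin.< w j → w j Fin.< w k → w k Fin.< w i → ⊥) where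

  -- The region spanned by the permutation matrix, known as its right hull: the cells with a point
  -- of `w` weakly to the upper left and another weakly to the lower right.
  H : Fin N → Fin N → Set
  H x y = (∃ λ p → p Fin.≤ x × y Fin.≤ w p) × (∃ λ q → x Fin.≤ q × w q Fin.≤ y)

  w-≢ : ∀ {x y} → x Fin.< y → w x ≢ w y
  w-≢ x<y eq = <-irrefl (cong toℕ (w-inj eq)) x<y

  strict : ∀ {x y} → x ≢ y → w x Fin.≤ w y → w x Fin.< w y
  strict x≢y le = ≤∧≢⇒< le (x≢y ∘ w-inj ∘ toℕ-injective)

  <⇒≢ : ∀ {x y : Fin N} → x Fin.< y → x ≢ y
  <⇒≢ x<y refl = <-irrefl refl x<y

  >⇒≢ : ∀ {x y : Fin N} → y Fin.< x → x ≢ y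
  >⇒≢ x>y refl = <-irrefl refl x>y

  module _ {v : Fin N → Fin N} (v-inj : Injective _≡_ _≡_ v) (v∈H : ∀ k → H k (v k))
           {i : Fin N} (agree : ∀ k → k Fin.< i → v k ≡ w k) where

    -- If v placed such a value at or before l, the last position where w is at most w i, it would have to place
    -- after l some value that w has between i and l, and that value completes a 3412 or a 4231.
    blocked : ∀ {q m l p} → q Fin.< i → i Fin.< l → w l Fin.< w i → (∀ x → l Fin.< x → w i Fin.< w x) →
              m Fin.≤ l → i Fin.< p → w p ≡ v m → w i Fin.< v m → v m Fin.< w q → ⊥
    blocked {q} {m} {l} {p} q<i i<l wl<wi last m≤l i<p wp≡vm wi<vm vm<wq with <-cmp p l
    ... | tri< p<l _ _ = no4231 q<i i<p p<l wl<wi (subst (w i Fin.<_) (sym wp≡vm) wi<vm)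
        (subst (Fin._< w q) (sym wp≡vm) vm<wq)
    ... | tri≈ _ refl _ = <-irrefl refl (<-trans wl<wi (subst (w i Fin.<_) (sym wp≡vm) wi<vm))
    ... | tri> _ _ l<p with escape v-inj w-inj (l <?_) l<p
            (λ x l<x vx≡wp → <-irrefl (cong toℕ (sym (v-inj (trans vx≡wp wp≡vm)))) (≤-<-trans m≤l l<x))
    ...   | x , p′ , l<x , l≮p′ , wp′≡vx = final (<-cmp i p′) (<-cmp (w p′) (w q))
      where
      wi<wp′ : w i Fin.< w p′
      wi<wp′ with proj₂ (v∈H x)
      ... | y , x≤y , wy≤vx = subst (w i Fin.<_) (sym wp′≡vx) (<-≤-trans (last y (<-≤-trans l<x x≤y)) wy≤vx)
      p′≢l : p′ ≢ l
      p′≢l refl = <-irrefl refl (<-trans wl<wi wi<wp′)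
      p′<l : p′ Fin.< l
      p′<l = ≤∧≢⇒< (≮⇒≥ l≮p′) (p′≢l ∘ toℕ-injective)
      final : _ → _ → ⊥
      final (tri> _ _ p′<i) _ = <-irrefl (cong toℕ (sym (v-inj (trans (sym wp′≡vx) (sym (agree p′ p′<i))))))
          (<-trans p′<l l<x)
      final (tri≈ _ refl _) _ = <-irrefl refl wi<wp′
      final (tri< i<p′ _ _) (tri< lt _ _) = no4231 q<i i<p′ p′<l wl<wi wi<wp′ lt
      final (tri< i<p′ _ _) (tri≈ _ eq _) = w-≢ (<-trans q<i i<p′) (sym eq)
      final (tri< i<p′ _ _) (tri> _ _ gt) =
        no3412 (<-trans q<i i<p′) p′<l l<p (<-trans wl<wi (subst (w i Fin.<_) (sym wp≡vm) wi<vm))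
               (subst (Fin._< w q) (sym wp≡vm) vm<wq) gt

    last≤wi : ∀ {y} → w y Fin.≤ w i →
      ∃ λ l → w l Fin.≤ w i × y Fin.≤ l × (∀ x → l Fin.< x → w i Fin.< w x)
    last≤wi wy≤ with greatest (λ l → w l ≤? w i) wy≤
    ... | l , wl≤ , y≤l , max = l , wl≤ , y≤l , λ x l<x → ≰⇒> (max x l<x)

    later : ∀ {m p} → i Fin.≤ m → w p ≡ v m → v m ≢ w i → i Fin.< p
    later {m} {p} i≤m wp≡vm vm≢wi with <-cmp i p
    ... | tri< lt _ _ = lt
    ... | tri≈ _ refl _ = ⊥-elim (vm≢wi (sym wp≡vm))
    ... | tri> _ _ p<i = ⊥-elim (<-irrefl (cong toℕ (v-inj (trans (agree p p<i) wp≡vm))) (<-≤-trans p<i i≤m))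

    later-v : ∀ {m} → v m ≡ w i → v i ≢ w i → i Fin.< m
    later-v {m} vm≡wi vi≢wi with <-cmp i m
    ... | tri< lt _ _ = lt
    ... | tri≈ _ refl _ = ⊥-elim (vi≢wi vm≡wi)
    ... | tri> _ _ m<i = ⊥-elim (w-≢ m<i (trans (sym (agree m m<i)) vm≡wi))

    -- The upper hull witness of `v i` must sit strictly before `i`. Since `v` still has to place
    -- the value `w i` later, the lower hull witness there puts a value of `w` that is at most `w i`
    -- beyond `i`. This is the configuration that `blocked` excludes.
    not-above : w i Fin.< v i → ⊥
    not-above wi<vi with injective⇒onto v-inj (w i) | injective⇒onto w-inj (v i) | proj₁ (v∈H i)
    ... | l₀ , vl₀≡wi | k , wk≡vi | q , q≤i , vi≤wq with proj₂ (v∈H l₀)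
    ... | y , l₀≤y , wy≤vl₀ with last≤wi (subst (w y Fin.≤_) vl₀≡wi wy≤vl₀)
    ... | l , wl≤wi , y≤l , last = blocked q<i i<l (strict (>⇒≢ i<l) wl≤wi) last (<⇒≤ i<l) i<k wk≡vi wi<vi vi<wq
      where
      vi≢wi : v i ≢ w i
      vi≢wi = >⇒≢ wi<vi
      i<k : i Fin.< k
      i<k = later ≤-refl wk≡vi vi≢wi
      i<l : i Fin.< l
      i<l = <-≤-trans (later-v vl₀≡wi vi≢wi) (≤-trans l₀≤y y≤l)
      q<i : q Fin.< i
      q<i = ≤∧≢⇒< q≤i λ eq → <-irrefl refl
          (<-≤-trans wi<vi (subst (λ z → v i Fin.≤ w z) (toℕ-injective eq) vi≤wq))
      vi<wq : v i Fin.< w q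
      vi<wq = subst (Fin._< w q) wk≡vi (strict (>⇒≢ (<-trans q<i i<k)) (subst (Fin._≤ w q) (sym wk≡vi) vi≤wq))

    -- So the first later position j whose v-value lies in (v i , w i] can be exchanged with i
    -- without leaving the hull.
    not-blocked-below : ∀ {j} → i Fin.< j → v i Fin.< v j → v j Fin.≤ w i →
      (∀ z → z Fin.< j → ¬ (i Fin.< z × v i Fin.< v z × v z Fin.≤ w i)) →
      (∀ y → j Fin.≤ y → v i Fin.< w y) → ⊥
    not-blocked-below {j} i<j vi<vj vj≤wi min above with proj₂ (v∈H j)
    ... | y , j≤y , wy≤vj with last≤wi (≤-trans wy≤vj vj≤wi)
    ... | l , wl≤wi , y≤l , last = goal
      where
      vi<wi : v i Fin.< w i
      vi<wi = <-≤-trans vi<vj vj≤wi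
      j≤l : j Fin.≤ l
      j≤l = ≤-trans j≤y y≤l
      i<l : i Fin.< l
      i<l = <-≤-trans i<j j≤l
      wl<wi : w l Fin.< w i
      wl<wi = strict (>⇒≢ i<l) wl≤wi
      early : ∀ {p} → w p Fin.≤ v i → p Fin.< j
      early {p} wp≤ with p <? j
      ... | yes p<j = p<j
      ... | no p≮j = ⊥-elim (<-irrefl refl (<-≤-trans (above p (≮⇒≥ p≮j)) wp≤))
      misses : ∀ {b} → b Fin.≤ j → ∀ x → x Fin.< b → v x ≢ w i
      misses b≤j x x<b vx≡wi = min x (<-≤-trans x<b b≤j)
        (later-v vx≡wi (<⇒≢ vi<wi) , subst (v i Fin.<_) (sym vx≡wi) vi<wi , subst (Fin._≤ w i)
            (sym vx≡wi) ≤-refl)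
      large : ∀ {x p} → x Fin.< j → ¬ (p Fin.≤ x) → w p ≡ v x → ¬ (w p Fin.≤ v i) → i Fin.≤ x × w i Fin.< v x
      large {x} {p} x<j p≰x wp≡vx big = i≤x , gt
        where
        i≤x : i Fin.≤ x
        i≤x with x <? i
        ... | no x≮i = ≮⇒≥ x≮i
        ... | yes x<i = ⊥-elim (p≰x (subst (Fin._≤ x) (sym (w-inj (trans wp≡vx (agree x x<i)))) ≤-refl))
        vi<vx : v i Fin.< v x
        vi<vx = subst (v i Fin.<_) wp≡vx (≰⇒> big)
        i<x : i Fin.< x
        i<x = ≤∧≢⇒< i≤x λ eq → <-irrefl (cong (λ z → toℕ (v z)) (toℕ-injective eq)) vi<vx
        gt : w i Fin.< v x
        gt with v x ≤? w i
        ... | yes le = ⊥-elim (min x x<j (i<x , vi<vx , le))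
        ... | no ≰ = ≰⇒> ≰
      via : ∀ {q x p} → q Fin.< i → x Fin.< j → i Fin.≤ x → w p ≡ v x → w i Fin.< v x → v x Fin.< w q → ⊥
      via q<i x<j i≤x wp≡vx wi<vx = blocked q<i i<l wl<wi last (≤-trans (<⇒≤ x<j) j≤l)
          (later i≤x wp≡vx (>⇒≢ wi<vx)) wp≡vx wi<vx
      below : ∀ {q x p} → q Fin.≤ x → ¬ (p Fin.≤ x) → w p ≡ v x → v x Fin.≤ w q → v x Fin.< w q
      below {q} {x} {p} q≤x p≰x wp≡vx le = subst (Fin._< w q) wp≡vx
        (strict (λ p≡q → p≰x (subst (Fin._≤ x) (sym p≡q) q≤x)) (subst (Fin._≤ w q) (sym wp≡vx) le))
      goal : ⊥
      -- `v` does not use `w i` before `j`, so some `m < j` receives a value that `w` has only at or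
      -- after `j`. By the choice of `j` this value exceeds `w i`, and `blocked` forces its upper
      -- hull witness `q` beyond `i`.
      goal with escape v-inj w-inj (_<? j) i<j (misses ≤-refl)
      ... | m , p , m<j , p≮j , wp≡vm
        with large m<j (λ p≤m → p≮j (≤-<-trans p≤m m<j)) wp≡vm (p≮j ∘ early) | proj₁ (v∈H m)
      ... | i≤m , wi<vm | q , q≤m , vm≤wq with <-cmp q i
      ... | tri< q<i _ _ = via q<i m<j i≤m wp≡vm wi<vm (below q≤m (λ p≤m → p≮j (≤-<-trans p≤m m<j)) wp≡vm vm≤wq)
      ... | tri≈ _ refl _ = <-irrefl refl (<-≤-trans wi<vm vm≤wq)
      -- The same pigeonhole is repeated with the bound `f`, the first position after `i` where `w`
      -- exceeds `w i`. The upper hull witness of the new value can no longer lie beyond `i`, for it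
      -- would be an earlier candidate for `f`.
      ... | tri> _ _ i<q with least (λ z → (i <? z) ×-dec (w i <? w z)) (i<q , <-≤-trans wi<vm vm≤wq)
      ... | f , (i<f , wi<wf) , f≤q , first with escape v-inj w-inj (_<? f) i<f (misses f≤j)
        where
        f≤j : f Fin.≤ j
        f≤j = ≤-trans f≤q (≤-trans q≤m (<⇒≤ m<j))
      ... | m₁ , p₁ , m₁<f , p₁≮f , wp₁≡vm₁ with large m₁<j p₁≰m₁ wp₁≡vm₁ too-low | proj₁ (v∈H m₁)
        where
        m₁<j : m₁ Fin.< j
        m₁<j = <-≤-trans m₁<f (≤-trans f≤q (≤-trans q≤m (<⇒≤ m<j)))
        p₁≰m₁ : ¬ (p₁ Fin.≤ m₁)
        p₁≰m₁ le = p₁≮f (≤-<-trans le m₁<f)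
        -- Here `p₁` may lie before `j`, so `early` alone is no contradiction; instead `i`, `f`,
        -- `p₁`, `l` form a 3412.
        too-low : ¬ (w p₁ Fin.≤ v i)
        too-low le with <-cmp f p₁
        ... | tri> _ _ p₁<f = p₁≮f p₁<f
        ... | tri≈ _ refl _ = <-irrefl refl (<-≤-trans (<-trans vi<wi wi<wf) le)
        ... | tri< f<p₁ _ _ = no3412 i<f f<p₁ (<-≤-trans (early le) j≤l)
            (≤-<-trans le (above l j≤l)) wl<wi wi<wf
      ... | i≤m₁ , wi<vm₁ | q₁ , q₁≤m₁ , vm₁≤wq₁ with <-cmp q₁ i
      ... | tri< q₁<i _ _ = via q₁<i (<-≤-trans m₁<f (≤-trans f≤q (≤-trans q≤m (<⇒≤ m<j)))) i≤m₁ wp₁≡vm₁ wi<vm₁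
              (below q₁≤m₁ (λ le → p₁≮f (≤-<-trans le m₁<f)) wp₁≡vm₁ vm₁≤wq₁)
      ... | tri≈ _ refl _ = <-irrefl refl (<-≤-trans wi<vm₁ vm₁≤wq₁)
      ... | tri> _ _ i<q₁ = first q₁ (≤-<-trans q₁≤m₁ m₁<f) (i<q₁ , <-≤-trans wi<vm₁ vm₁≤wq₁)

  hull-ascent : ∀ {v : Fin N → Fin N} → Injective _≡_ _≡_ v → (∀ k → H k (v k)) → ∀ {k} → v k ≢ w k →
    ∃ λ i → ∃ λ j → i Fin.< j × v i Fin.< v j × H i (v j) × H j (v i)
  hull-ascent {v} v-inj v∈H vk≢wk with least (λ k → ¬? (v k ≟ w k)) vk≢wk
  ... | i , vi≢wi , _ , min = go (<-cmp (v i) (w i))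
    where
    agree : ∀ k → k Fin.< i → v k ≡ w k
    agree k k<i with v k ≟ w k
    ... | yes eq = eq
    ... | no neq = ⊥-elim (min k k<i neq)
    go : _ → _
    go (tri≈ _ eq _) = ⊥-elim (vi≢wi eq)
    go (tri> _ _ gt) = ⊥-elim (not-above v-inj v∈H agree gt)
    go (tri< vi<wi _ _) with injective⇒onto v-inj (w i)
    ... | j₀ , vj₀≡wi with least (λ z → (i <? z) ×-dec ((v i <? v z) ×-dec (v z ≤? w i)))
            (later-v v-inj v∈H agree vj₀≡wi vi≢wi , subst (v i Fin.<_) (sym vj₀≡wi) vi<wi , subst (Fin._≤ w i)
                (sym vj₀≡wi) ≤-refl)
    ... | j , (i<j , vi<vj , vj≤wi) , _ , first with any? (λ y → (j ≤? y) ×-dec (w y ≤? v i))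
    ... | no ¬low = ⊥-elim (not-blocked-below v-inj v∈H agree i<j vi<vj vj≤wi first
                      λ y j≤y → ≰⇒> λ le → ¬low (y , j≤y , le))
    ... | yes low with v∈H i | v∈H j
    ... | _ , (q , i≤q , wq≤vi) | (p , p≤j , vj≤wp) , _ =
      -- `i` is its own upper witness for `v j` because `v j ≤ w i`, and `low` is the lower witness
      -- for `v i` at `j`. The other two witnesses are inherited, as `v i < v j`.
      i , j , i<j , vi<vj , ((i , ≤-refl , vj≤wi) , (q , i≤q , ≤-trans wq≤vi (<⇒≤ vi<vj))) ,
      ((p , p≤j , ≤-trans (<⇒≤ vi<vj) vj≤wp) , low)

-- Negation and the reflections of signed permutations

private
  variable
    n : ℕ

opposite-< : ∀ {m} {x y : Fin m} → x Fin.< y → opposite y Fin.< opposite x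
opposite-< {m} {x} {y} x<y =
  subst₂ ℕ._<_ (sym (opposite-prop y)) (sym (opposite-prop x)) (∸-monoʳ-< (s≤s x<y) (toℕ<n y))

opposite-≤ : ∀ {m} {x y : Fin m} → x Fin.≤ y → opposite y Fin.≤ opposite x
opposite-≤ {m} {x} {y} x≤y =
  subst₂ ℕ._≤_ (sym (opposite-prop y)) (sym (opposite-prop x)) (∸-monoʳ-≤ m (s≤s x≤y))

opposite-injective : ∀ {m} {x y : Fin m} → opposite x ≡ opposite y → x ≡ y
opposite-injective {x = x} {y} eq =
  trans (sym (opposite-involutive x)) (trans (cong opposite eq) (opposite-involutive y))

opposite-suc≡ : ∀ {m} {x y : Fin m} → toℕ y ≡ suc (toℕ x) → toℕ (opposite x) ≡ suc (toℕ (opposite y))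
opposite-suc≡ {m} {x} {y} eq = begin
  toℕ (opposite x)               ≡⟨ opposite-prop x ⟩
  m ∸ suc (toℕ x)                ≡⟨ cong (m ∸_) (sym eq) ⟩
  m ∸ toℕ y                      ≡⟨ ℕₚ.+-∸-assoc 1 (toℕ<n y) ⟩
  suc (m ∸ suc (toℕ y))          ≡⟨ cong suc (sym (opposite-prop y)) ⟩
  suc (toℕ (opposite y))         ∎
  where open ≡-Reasoning

Elt-ext : {u v : Elt n} → (∀ k → u ⟨ k ⟩ ≡ v ⟨ k ⟩) → u ≡ v
Elt-ext {u = mkE us} {mkE vs} eq =
  cong mkE (trans (sym (tabulate∘lookup us)) (trans (tabulate-cong eq) (tabulate∘lookup vs)))

·-⟨⟩ : (u v : Elt n) → ∀ k → (u · v) ⟨ k ⟩ ≡ u ⟨ v ⟨ k ⟩ ⟩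
·-⟨⟩ u v = lookup∘tabulate _

idE-⟨⟩ : ∀ n k → idE {n} ⟨ k ⟩ ≡ k
idE-⟨⟩ n = lookup∘tabulate _

_≟E_ : (u v : Elt n) → Dec (u ≡ v)
mkE us ≟E mkE vs = map′ (cong mkE) (cong Elt.oneLine) (≡-dec _≟_ us vs)

Inj : Elt n → Set
Inj v = Injective _≡_ _≡_ (v ⟨_⟩)

Signed : Elt n → Set
Signed v = ∀ k → v ⟨ opposite k ⟩ ≡ opposite (v ⟨ k ⟩)

-- t acts as the reflection (x y)(x̄ ȳ), which is the transposition (x x̄) when y = x̄.
record IsRefl (t : Elt n) (x y : Idx n) : Set where
  field
    to     : t ⟨ x ⟩ ≡ y
    fro    : t ⟨ y ⟩ ≡ x
    bar-to  : t ⟨ opposite x ⟩ ≡ opposite y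
    bar-fro : t ⟨ opposite y ⟩ ≡ opposite x
    fixes  : ∀ {k} → k ≢ x → k ≢ y → k ≢ opposite x → k ≢ opposite y → t ⟨ k ⟩ ≡ k

open IsRefl

refl-sym : {t : Elt n} {x y : Idx n} → IsRefl t x y → IsRefl t y x
refl-sym r = record
  { to = fro r ; fro = to r ; bar-to = bar-fro r ; bar-fro = bar-to r
  ; fixes = λ a b c d → fixes r b a d c }

refl-bar : {t : Elt n} {x y : Idx n} → IsRefl t x y → IsRefl t (opposite x) (opposite y)
refl-bar {t = t} {x} {y} r = record
  { to = bar-to r ; fro = bar-fro r
  ; bar-to = trans (cong (t ⟨_⟩) (opposite-involutive x)) (trans (to r) (sym (opposite-involutive y)))
  ; bar-fro = trans (cong (t ⟨_⟩) (opposite-involutive y)) (trans (fro r) (sym (opposite-involutive x)))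
  ; fixes = λ a b c d → fixes r (λ e → c (trans e (sym (opposite-involutive x))))
                                (λ e → d (trans e (sym (opposite-involutive y)))) a b }

data Place {m} (x y : Fin m) : Fin m → Set where
  at-x  : Place x y x
  at-y  : Place x y y
  at-x̄  : Place x y (opposite x)
  at-ȳ  : Place x y (opposite y)
  other : ∀ {k} → k ≢ x → k ≢ y → k ≢ opposite x → k ≢ opposite y → Place x y k

place : ∀ {m} (x y k : Fin m) → Place x y k
place x y k with k ≟ x | k ≟ y | k ≟ opposite x | k ≟ opposite y
... | yes refl | _ | _ | _ = at-x
... | no _ | yes refl | _ | _ = at-y
... | no _ | no _ | yes refl | _ = at-x̄
... | no _ | no _ | no _ | yes refl = at-ȳ
... | no a | no b | no c | no d = other a b c d

refl-unique : {t t′ : Elt n} {x y : Idx n} → IsRefl t x y → IsRefl t′ x y → t ≡ t′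
refl-unique {t = t} {t′} {x} {y} r r′ = Elt-ext λ k → go (place x y k)
  where
  go : ∀ {k} → Place x y k → t ⟨ k ⟩ ≡ t′ ⟨ k ⟩
  go at-x = trans (to r) (sym (to r′))
  go at-y = trans (fro r) (sym (fro r′))
  go at-x̄ = trans (bar-to r) (sym (bar-to r′))
  go at-ȳ = trans (bar-fro r) (sym (bar-fro r′))
  go (other a b c d) = trans (fixes r a b c d) (sym (fixes r′ a b c d))

refl-involutive : {t : Elt n} {x y : Idx n} → IsRefl t x y → ∀ k → t ⟨ t ⟨ k ⟩ ⟩ ≡ k
refl-involutive {t = t} {x} {y} r k = go (place x y k)
  where
  go : ∀ {k} → Place x y k → t ⟨ t ⟨ k ⟩ ⟩ ≡ k
  go at-x = trans (cong (t ⟨_⟩) (to r)) (fro r)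
  go at-y = trans (cong (t ⟨_⟩) (fro r)) (to r)
  go at-x̄ = trans (cong (t ⟨_⟩) (bar-to r)) (bar-fro r)
  go at-ȳ = trans (cong (t ⟨_⟩) (bar-fro r)) (bar-to r)
  go (other a b c d) = trans (cong (t ⟨_⟩) (fixes r a b c d)) (fixes r a b c d)

refl-injective : {t : Elt n} {x y : Idx n} → IsRefl t x y → Inj t
refl-injective {t = t} r {a} {b} eq =
  trans (sym (refl-involutive r a)) (trans (cong (t ⟨_⟩) eq) (refl-involutive r b))

refl-signed : {t : Elt n} {x y : Idx n} → IsRefl t x y → Signed t
refl-signed {t = t} {x} {y} r k = go (place x y k)
  where
  go : ∀ {k} → Place x y k → t ⟨ opposite k ⟩ ≡ opposite (t ⟨ k ⟩)
  go at-x = trans (bar-to r) (cong opposite (sym (to r)))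
  go at-y = trans (bar-fro r) (cong opposite (sym (fro r)))
  go at-x̄ = trans (bar-to (refl-bar r)) (cong opposite (sym (bar-to r)))
  go at-ȳ = trans (bar-fro (refl-bar r)) (cong opposite (sym (bar-fro r)))
  go {k} (other a b c d) = trans
    (fixes r (λ e → c (flipped e)) (λ e → d (flipped e)) (a ∘ opposite-injective) (b ∘ opposite-injective))
    (cong opposite (sym (fixes r a b c d)))
    where
    flipped : ∀ {z} → opposite k ≡ z → k ≡ opposite z
    flipped e = trans (sym (opposite-involutive k)) (cong opposite e)

-- Allows the exchanged pair to be read off from a single moved index, whichever of the four it is.
refl-moved : {t : Elt n} {a b x y : Idx n} → IsRefl t a b → t ⟨ x ⟩ ≡ y → x ≢ y → IsRefl t x y
refl-moved {t = t} {a} {b} {x} r tx≡y x≢y = go (place a b x) tx≡y x≢y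
  where
  go : ∀ {x y} → Place a b x → t ⟨ x ⟩ ≡ y → x ≢ y → IsRefl t x y
  go at-x eq _ = subst (IsRefl t _) (trans (sym (to r)) eq) r
  go at-y eq _ = subst (IsRefl t _) (trans (sym (fro r)) eq) (refl-sym r)
  go at-x̄ eq _ = subst (IsRefl t _) (trans (sym (bar-to r)) eq) (refl-bar r)
  go at-ȳ eq _ = subst (IsRefl t _) (trans (sym (bar-fro r)) eq) (refl-sym (refl-bar r))
  go (other p q s u) eq ne = ⊥-elim (ne (trans (sym (fixes r p q s u)) eq))

module _ (g g⁻ : Elt n) (g-signed : Signed g) (gg⁻ : ∀ k → g ⟨ g⁻ ⟨ k ⟩ ⟩ ≡ k)
    (g⁻g : ∀ k → g⁻ ⟨ g ⟨ k ⟩ ⟩ ≡ k) where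

  refl-conj : {s t : Elt n} → (∀ k → t ⟨ k ⟩ ≡ g⁻ ⟨ s ⟨ g ⟨ k ⟩ ⟩ ⟩) →
              ∀ {x y} → IsRefl s (g ⟨ x ⟩) (g ⟨ y ⟩) → IsRefl t x y
  refl-conj {s} {t} t≡ {x} {y} r = record
    { to = via (to r)
    ; fro = via (fro r)
    ; bar-to = via (barred (bar-to r))
    ; bar-fro = via (barred (bar-fro r))
    ; fixes = λ a b c d → via (fixes r (a ∘ g-inj) (b ∘ g-inj)
        (λ e → c (g-inj (trans e (sym (g-signed x))))) (λ e → d (g-inj (trans e (sym (g-signed y)))))) }
    where
    g-inj : ∀ {a b} → g ⟨ a ⟩ ≡ g ⟨ b ⟩ → a ≡ b
    g-inj {a} {b} e = trans (sym (g⁻g a)) (trans (cong (g⁻ ⟨_⟩) e) (g⁻g b))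
    via : ∀ {a b} → s ⟨ g ⟨ a ⟩ ⟩ ≡ g ⟨ b ⟩ → t ⟨ a ⟩ ≡ b
    via {a} {b} e = trans (t≡ a) (trans (cong (g⁻ ⟨_⟩) e) (g⁻g b))
    barred : ∀ {a b} → s ⟨ opposite (g ⟨ a ⟩) ⟩ ≡ opposite (g ⟨ b ⟩) → s ⟨ g ⟨ opposite a ⟩ ⟩ ≡ g ⟨ opposite b ⟩
    barred {a} {b} e = trans (cong (s ⟨_⟩) (g-signed a)) (trans e (sym (g-signed b)))

-- The generators as exchanges of neighbouring indices

module _ {n : ℕ} where

  swapE-⟨⟩ : (a b k : Idx n) → swapE {n} a b ⟨ k ⟩ ≡ (if k == a then b else (if k == b then a else k))
  swapE-⟨⟩ a b = lookup∘tabulate _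

  swapE-left : (a b : Idx n) → swapE {n} a b ⟨ a ⟩ ≡ b
  swapE-left a b rewrite swapE-⟨⟩ a b a with a ≟ a
  ... | yes _ = refl
  ... | no a≢a = ⊥-elim (a≢a refl)

  swapE-right : (a b : Idx n) → swapE {n} a b ⟨ b ⟩ ≡ a
  swapE-right a b rewrite swapE-⟨⟩ a b b with b ≟ a | b ≟ b
  ... | yes b≡a | _ = b≡a
  ... | no _ | yes _ = refl
  ... | no _ | no b≢b = ⊥-elim (b≢b refl)

  swapE-other : {a b k : Idx n} → k ≢ a → k ≢ b → swapE {n} a b ⟨ k ⟩ ≡ k
  swapE-other {a} {b} {k} k≢a k≢b rewrite swapE-⟨⟩ a b k with k ≟ a | k ≟ b
  ... | yes e | _ = ⊥-elim (k≢a e)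
  ... | no _ | yes e = ⊥-elim (k≢b e)
  ... | no _ | no _ = refl

  swapE-involutive : (a b k : Idx n) → swapE {n} a b ⟨ swapE {n} a b ⟨ k ⟩ ⟩ ≡ k
  swapE-involutive a b k with k ≟ a
  ... | yes refl = trans (cong (swapE {n} a b ⟨_⟩) (swapE-left a b)) (swapE-right a b)
  ... | no k≢a with k ≟ b
  ...   | yes refl = trans (cong (swapE {n} a b ⟨_⟩) (swapE-right a b)) (swapE-left a b)
  ...   | no k≢b = trans (cong (swapE {n} a b ⟨_⟩) (swapE-other k≢a k≢b)) (swapE-other k≢a k≢b)

  pos-≥ : (i : Fin n) → n ℕ.≤ toℕ (pos i)
  pos-≥ i = subst (n ℕ.≤_) (sym (toℕ-↑ʳ n i)) (m≤m+n n (toℕ i))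

  opposite-low : {k : Idx n} → n ℕ.≤ toℕ k → toℕ (opposite k) ℕ.< n
  opposite-low {k} n≤k = subst (ℕ._< n) (sym (opposite-prop k))
    (≤-trans (s≤s (∸-monoʳ-≤ (n ℕ.+ n) (s≤s n≤k)))
      (subst (ℕ._≤ n) (ℕₚ.+-∸-assoc 1 (≤-trans (s≤s n≤k) (toℕ<n k))) (≤-reflexive (m+n∸n≡m n n))))

  opposite-high : {k : Idx n} → toℕ k ℕ.< n → n ℕ.≤ toℕ (opposite k)
  opposite-high {k} k<n = subst (n ℕ.≤_) (sym (opposite-prop k))
    (subst (ℕ._≤ n ℕ.+ n ∸ suc (toℕ k)) (m+n∸n≡m n n) (∸-monoʳ-≤ (n ℕ.+ n) k<n))

  pos≢neg : (i j : Fin n) → pos i ≢ neg j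
  pos≢neg i j eq = <-irrefl refl
    (≤-<-trans (pos-≥ i) (subst (λ z → toℕ z ℕ.< n) (sym eq) (opposite-low (pos-≥ j))))

gen-zero-refl : IsRefl (gen {suc n} Fin.zero) (neg Fin.zero) (pos Fin.zero)
gen-zero-refl {n} = record
  { to = swapE-right {suc n} p (opposite p)
  ; fro = swapE-left {suc n} p (opposite p)
  ; bar-to = trans (cong (gen {suc n} Fin.zero ⟨_⟩) (opposite-involutive p)) (swapE-left {suc n} p (opposite p))
  ; bar-fro = trans (swapE-right {suc n} p (opposite p)) (sym (opposite-involutive p))
  ; fixes = λ a b _ _ → swapE-other {suc n} b a }
  where
  p : Idx (suc n)
  p = pos Fin.zero

gen-suc-refl : (i : Fin n) → IsRefl (gen {suc n} (Fin.suc i)) (pos (inject₁ i)) (pos (Fin.suc i))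
gen-suc-refl {n} i = record
  { to = via p (swapE-other {suc n} (pos≢neg i₀ i₀) (pos≢neg i₀ i₁)) (swapE-left {suc n} p q)
  ; fro = via q (swapE-other {suc n} (pos≢neg i₁ i₀) (pos≢neg i₁ i₁)) (swapE-right {suc n} p q)
  ; bar-to = via p̄ (swapE-left {suc n} p̄ q̄) (swapE-other {suc n} (pos≢neg i₀ i₁ ∘ sym) (pos≢neg i₁ i₁ ∘ sym))
  ; bar-fro = via q̄ (swapE-right {suc n} p̄ q̄)
      (swapE-other {suc n} (pos≢neg i₀ i₀ ∘ sym) (pos≢neg i₁ i₀ ∘ sym))
  ; fixes = λ {k} a b c d → via k (swapE-other {suc n} c d) (swapE-other {suc n} a b) }
  where
  i₀ i₁ : Fin (suc n)
  i₀ = inject₁ i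
  i₁ = Fin.suc i
  p q p̄ q̄ : Idx (suc n)
  p = pos i₀
  q = pos i₁
  p̄ = opposite p
  q̄ = opposite q
  via : ∀ k {l m} → swapE {suc n} p̄ q̄ ⟨ k ⟩ ≡ l → swapE {suc n} p q ⟨ l ⟩ ≡ m →
      gen {suc n} (Fin.suc i) ⟨ k ⟩ ≡ m
  via k e f = trans (·-⟨⟩ (swapE {suc n} p q) (swapE {suc n} p̄ q̄) k)
      (trans (cong (swapE {suc n} p q ⟨_⟩) e) f)

neg-zero-suc : toℕ (pos {suc n} Fin.zero) ≡ suc (toℕ (neg {suc n} Fin.zero))
neg-zero-suc {n} = begin
  toℕ (pos {suc n} Fin.zero)                     ≡⟨ toℕ-↑ʳ (suc n) (Fin.zero {n}) ⟩
  suc n ℕ.+ 0                                    ≡⟨ +-identityʳ (suc n) ⟩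
  suc n                                          ≡⟨ cong suc (sym (m+n∸n≡m n (suc n))) ⟩
  suc (suc (n ℕ.+ suc n) ∸ suc (suc n))          ≡⟨ cong (λ z → suc (suc (n ℕ.+ suc n) ∸ suc z))
      (sym (trans (toℕ-↑ʳ (suc n) (Fin.zero {n})) (+-identityʳ (suc n)))) ⟩
  suc (suc (n ℕ.+ suc n) ∸ suc (toℕ (pos {suc n} Fin.zero))) ≡⟨ cong suc
      (sym (opposite-prop (pos {suc n} Fin.zero))) ⟩
  suc (toℕ (neg {suc n} Fin.zero))               ∎
  where open ≡-Reasoning

-- As there is no label 0, the labels 1̄ and 1 are neighbouring indices too. The sign change thus
-- has the same form as the other generators, and the exchange argument need not treat it apart.
gen-refl : (s : Fin n) → ∃ λ a → ∃ λ b → toℕ b ≡ suc (toℕ a) × IsRefl (gen s) a b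
gen-refl {suc n} Fin.zero = _ , _ , neg-zero-suc {n} , gen-zero-refl
gen-refl {suc n} (Fin.suc i) = _ , _ , adj , gen-suc-refl i
  where
  adj : toℕ (pos (Fin.suc i)) ≡ suc (toℕ (pos (inject₁ i)))
  adj = trans (toℕ-↑ʳ (suc n) (Fin.suc i)) (trans (+-suc (suc n) (toℕ i))
        (cong suc (trans (cong (suc n ℕ.+_) (sym (toℕ-inject₁ i))) (sym (toℕ-↑ʳ (suc n) (inject₁ i))))))

pos-surj : (k : Idx n) → n ℕ.≤ toℕ k → ∃ λ i → pos i ≡ k
pos-surj {n} k n≤k = i , toℕ-injective
    (trans (toℕ-↑ʳ n i) (trans (cong (n ℕ.+_) (toℕ-fromℕ< lt)) (m+[n∸m]≡n n≤k)))
  where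
  lt : toℕ k ∸ n ℕ.< n
  lt = ℕₚ.+-cancelˡ-< n _ _ (subst (ℕ._< n ℕ.+ n) (sym (m+[n∸m]≡n n≤k)) (toℕ<n k))
  i = fromℕ< lt

adjacent-pos : {a b : Idx n} → toℕ b ≡ suc (toℕ a) → n ℕ.≤ toℕ a → ∃ λ (s : Fin n) → IsRefl (gen s) a b
adjacent-pos {n} {a} {b} adj n≤a
  with pos-surj a n≤a | pos-surj b (≤-trans n≤a (subst (toℕ a ℕ.≤_) (sym adj) (n≤1+n _)))
... | i , refl | j , refl = go i j (suc-step i j adj)
  where
  suc-step : ∀ i j → toℕ (pos {n} j) ≡ suc (toℕ (pos {n} i)) → toℕ j ≡ suc (toℕ i)
  suc-step i j eq = +-cancelˡ-≡ n _ _
      (trans (sym (toℕ-↑ʳ n j)) (trans eq (trans (cong suc (toℕ-↑ʳ n i)) (sym (+-suc n (toℕ i))))))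
  go : ∀ {n} (i j : Fin n) → toℕ j ≡ suc (toℕ i) → ∃ λ (s : Fin n) → IsRefl (gen s) (pos i) (pos j)
  go i (Fin.suc j) eq = Fin.suc j , subst (λ z → IsRefl (gen (Fin.suc j)) (pos z) (pos (Fin.suc j)))
    (toℕ-injective (trans (toℕ-inject₁ j) (suc-injective eq))) (gen-suc-refl j)

adjacent-gen : {a b : Idx n} → toℕ b ≡ suc (toℕ a) → ∃ λ (s : Fin n) → IsRefl (gen s) a b
adjacent-gen {n} {a} {b} adj with n ℕ.≤? toℕ a | n ℕ.≤? toℕ b
... | yes n≤a | _ = adjacent-pos adj n≤a
... | no n≰a | no n≰b with adjacent-pos (opposite-suc≡ adj) (opposite-high (≰⇒> n≰b))
...   | s , r = s , subst₂ (IsRefl (gen s)) (opposite-involutive a) (opposite-involutive b)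
    (refl-sym (refl-bar r))
adjacent-gen {zero} {a = ()} adj | no _ | yes _
adjacent-gen {suc n} {a} {b} adj | no n≰a | yes n≤b = Fin.zero , subst₂
    (IsRefl (gen Fin.zero)) neg≡a pos≡b gen-zero-refl
  where
  b≡n : toℕ b ≡ suc n
  b≡n = ≤-antisym (subst (ℕ._≤ suc n) (sym adj) (≰⇒> n≰a)) n≤b
  pos≡b : pos {suc n} Fin.zero ≡ b
  pos≡b = toℕ-injective (trans (toℕ-↑ʳ (suc n) Fin.zero) (trans (+-identityʳ (suc n)) (sym b≡n)))
  neg≡a : neg {suc n} Fin.zero ≡ a
  neg≡a = toℕ-injective (suc-injective (trans (sym (neg-zero-suc {n})) (trans (cong toℕ pos≡b) adj)))

gen-near : (s : Fin n) (k : Idx n) → toℕ (gen s ⟨ k ⟩) ℕ.≤ suc (toℕ k) × toℕ k ℕ.≤ suc (toℕ (gen s ⟨ k ⟩))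
gen-near {n} s k with gen-refl s
... | a , b , adj , r = go (place a b k)
  where
  Near : Idx n → Set
  Near k = toℕ (gen s ⟨ k ⟩) ℕ.≤ suc (toℕ k) × toℕ k ℕ.≤ suc (toℕ (gen s ⟨ k ⟩))
  up : ∀ {k l} → gen s ⟨ k ⟩ ≡ l → toℕ l ≡ suc (toℕ k) → Near k
  up {k} {l} refl e = ≤-reflexive e , ≤-trans (n≤1+n _) (≤-trans (≤-reflexive (sym e)) (n≤1+n _))
  down : ∀ {k l} → gen s ⟨ k ⟩ ≡ l → toℕ k ≡ suc (toℕ l) → Near k
  down {k} {l} refl e = ≤-trans (n≤1+n _) (≤-trans (≤-reflexive (sym e)) (n≤1+n _)) , ≤-reflexive e
  go : ∀ {k} → Place a b k → Near k
  go at-x = up (to r) adj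
  go at-y = down (fro r) adj
  go at-x̄ = down (bar-to r) (opposite-suc≡ adj)
  go at-ȳ = up (bar-fro r) (opposite-suc≡ adj)
  go {k} (other p q c d) = subst (λ z → toℕ z ℕ.≤ suc (toℕ k) × toℕ k ℕ.≤ suc (toℕ z)) (sym (fixes r p q c d))
      (n≤1+n _ , n≤1+n _)

-- A generator moves every index by at most one, so a pair it inverts is a pair it exchanges.
gen-inverts : (s : Fin n) {x y : Idx n} → x Fin.< y → gen s ⟨ y ⟩ Fin.< gen s ⟨ x ⟩ → IsRefl (gen s) x y
gen-inverts s {x} {y} x<y inv with gen-refl s
... | _ , _ , _ , r = refl-moved r (toℕ-injective (≤-antisym le ge)) (λ e → <-irrefl (cong toℕ e) x<y)
  where
  le : toℕ (gen s ⟨ x ⟩) ℕ.≤ toℕ y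
  le = ≤-trans (proj₁ (gen-near s x)) x<y
  ge : toℕ y ℕ.≤ toℕ (gen s ⟨ x ⟩)
  ge = ≤-trans (proj₂ (gen-near s y)) inv

-- Words in the generators and the exchange property

prodW-++ : (xs ys : List (Fin n)) (k : Idx n) → prodW (xs ++ ys) ⟨ k ⟩ ≡ prodW xs ⟨ prodW ys ⟨ k ⟩ ⟩
prodW-++ {n} [] ys k = sym (idE-⟨⟩ n _)
prodW-++ (x ∷ xs) ys k = trans (·-⟨⟩ (gen x) (prodW (xs ++ ys)) k)
    (trans (cong (gen x ⟨_⟩) (prodW-++ xs ys k)) (sym (·-⟨⟩ (gen x) (prodW xs) _)))

prodW-single : (s : Fin n) (k : Idx n) → prodW [ s ] ⟨ k ⟩ ≡ gen s ⟨ k ⟩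
prodW-single {n} s k = trans (·-⟨⟩ (gen s) idE k) (cong (gen s ⟨_⟩) (idE-⟨⟩ n k))

gen-involutive : (s : Fin n) (k : Idx n) → gen s ⟨ gen s ⟨ k ⟩ ⟩ ≡ k
gen-involutive s with gen-refl s
... | _ , _ , _ , r = refl-involutive r

prodW-reverse : (xs : List (Fin n)) (k : Idx n) → prodW (reverse xs) ⟨ prodW xs ⟨ k ⟩ ⟩ ≡ k
prodW-reverse {n} [] k = trans (idE-⟨⟩ n _) (idE-⟨⟩ n k)
prodW-reverse (x ∷ xs) k = begin
  prodW (reverse (x ∷ xs)) ⟨ (gen x · prodW xs) ⟨ k ⟩ ⟩
    ≡⟨ cong₂ (λ ws z → prodW ws ⟨ z ⟩) (unfold-reverse x xs) (·-⟨⟩ (gen x) (prodW xs) k) ⟩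
  prodW (reverse xs ++ [ x ]) ⟨ gen x ⟨ prodW xs ⟨ k ⟩ ⟩ ⟩
    ≡⟨ prodW-++ (reverse xs) [ x ] _ ⟩
  prodW (reverse xs) ⟨ prodW [ x ] ⟨ gen x ⟨ prodW xs ⟨ k ⟩ ⟩ ⟩ ⟩
    ≡⟨ cong (prodW (reverse xs) ⟨_⟩) (trans (prodW-single x _) (gen-involutive x _)) ⟩
  prodW (reverse xs) ⟨ prodW xs ⟨ k ⟩ ⟩
    ≡⟨ prodW-reverse xs k ⟩
  k ∎
  where open ≡-Reasoning

prodW-reverse′ : (xs : List (Fin n)) (k : Idx n) → prodW xs ⟨ prodW (reverse xs) ⟨ k ⟩ ⟩ ≡ k
prodW-reverse′ xs k = trans (cong (λ ws → prodW ws ⟨ prodW (reverse xs) ⟨ k ⟩ ⟩) (sym (reverse-involutive xs)))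
    (prodW-reverse (reverse xs) k)

prodW-signed : (xs : List (Fin n)) → Signed (prodW xs)
prodW-signed {n} [] k = trans (idE-⟨⟩ n _) (cong opposite (sym (idE-⟨⟩ n k)))
prodW-signed (x ∷ xs) k with gen-refl x
... | _ , _ , _ , r = begin
  (gen x · prodW xs) ⟨ opposite k ⟩      ≡⟨ ·-⟨⟩ (gen x) (prodW xs) _ ⟩
  gen x ⟨ prodW xs ⟨ opposite k ⟩ ⟩      ≡⟨ cong (gen x ⟨_⟩) (prodW-signed xs k) ⟩
  gen x ⟨ opposite (prodW xs ⟨ k ⟩) ⟩    ≡⟨ refl-signed r _ ⟩
  opposite (gen x ⟨ prodW xs ⟨ k ⟩ ⟩)    ≡⟨ cong opposite (sym (·-⟨⟩ (gen x) (prodW xs) k)) ⟩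
  opposite ((gen x · prodW xs) ⟨ k ⟩)    ∎
  where open ≡-Reasoning

conjugate-⟨⟩ : (ws : List (Fin n)) (s : Fin n) (vs : List (Fin n)) (k : Idx n) →
  prodW (ws ++ s ∷ vs) ⟨ k ⟩ ≡ prodW ws ⟨ gen s ⟨ prodW vs ⟨ k ⟩ ⟩ ⟩
conjugate-⟨⟩ ws s vs k = trans (prodW-++ ws (s ∷ vs) k) (cong (prodW ws ⟨_⟩) (·-⟨⟩ (gen s) (prodW vs) k))

-- Following the pair x < y through a word that inverts it, some letter exchanges it; deleting that letter
-- multiplies by the reflection of the pair.
exchange : (ss : List (Fin n)) {x y : Idx n} → x Fin.< y → prodW ss ⟨ y ⟩ Fin.< prodW ss ⟨ x ⟩ →
  ∃ λ ss′ → ∃ λ t → suc (length ss′) ≡ length ss × Reflection t × IsRefl t x y × prodW ss′ ≡ prodW ss · t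
exchange {n} [] x<y inv = ⊥-elim (<-irrefl refl (<-trans x<y (subst₂ Fin._<_ (idE-⟨⟩ n _) (idE-⟨⟩ n _) inv)))
exchange (s ∷ ss) {x} {y} x<y inv with <-cmp (prodW ss ⟨ x ⟩) (prodW ss ⟨ y ⟩)
... | tri≈ _ e _ = ⊥-elim (<-irrefl
    (cong toℕ (trans (sym (prodW-reverse ss x))
    (trans (cong (prodW (reverse ss) ⟨_⟩) e) (prodW-reverse ss y)))) x<y)
... | tri> _ _ gt with exchange ss x<y gt
...   | ss′ , t , len , isr , r , eq = s ∷ ss′ , t , cong suc len , isr , r , Elt-ext pointwise
  where
  pointwise : ∀ k → prodW (s ∷ ss′) ⟨ k ⟩ ≡ (prodW (s ∷ ss) · t) ⟨ k ⟩
  pointwise k = begin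
    (gen s · prodW ss′) ⟨ k ⟩             ≡⟨ ·-⟨⟩ (gen s) (prodW ss′) k ⟩
    gen s ⟨ prodW ss′ ⟨ k ⟩ ⟩             ≡⟨ cong (λ u → gen s ⟨ u ⟨ k ⟩ ⟩) eq ⟩
    gen s ⟨ (prodW ss · t) ⟨ k ⟩ ⟩        ≡⟨ cong (gen s ⟨_⟩) (·-⟨⟩ (prodW ss) t k) ⟩
    gen s ⟨ prodW ss ⟨ t ⟨ k ⟩ ⟩ ⟩        ≡⟨ sym (·-⟨⟩ (gen s) (prodW ss) _) ⟩
    prodW (s ∷ ss) ⟨ t ⟨ k ⟩ ⟩            ≡⟨ sym (·-⟨⟩ (prodW (s ∷ ss)) t k) ⟩
    (prodW (s ∷ ss) · t) ⟨ k ⟩            ∎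
    where open ≡-Reasoning
exchange {n} (s ∷ ss) {x} {y} x<y inv | tri< lt _ _ = ss , t , refl ,
    (reverse ss , s , refl) , r , Elt-ext pointwise
  where
  g g⁻ t : Elt n
  g = prodW ss
  g⁻ = prodW (reverse ss)
  t = prodW (reverse ss ++ s ∷ reverse (reverse ss))
  t-⟨⟩ : ∀ k → t ⟨ k ⟩ ≡ g⁻ ⟨ gen s ⟨ g ⟨ k ⟩ ⟩ ⟩
  t-⟨⟩ k = trans (cong (λ ws → prodW (reverse ss ++ s ∷ ws) ⟨ k ⟩) (reverse-involutive ss))
      (conjugate-⟨⟩ (reverse ss) s ss k)
  r : IsRefl t x y
  r = refl-conj g g⁻ (prodW-signed ss) (prodW-reverse′ ss) (prodW-reverse ss) t-⟨⟩
        (gen-inverts s lt (subst₂ Fin._<_ (·-⟨⟩ (gen s) g y) (·-⟨⟩ (gen s) g x) inv))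
  pointwise : ∀ k → g ⟨ k ⟩ ≡ (prodW (s ∷ ss) · t) ⟨ k ⟩
  pointwise k = begin
    g ⟨ k ⟩                                          ≡⟨ sym (gen-involutive s _) ⟩
    gen s ⟨ gen s ⟨ g ⟨ k ⟩ ⟩ ⟩                      ≡⟨ cong (gen s ⟨_⟩) (sym (prodW-reverse′ ss _)) ⟩
    gen s ⟨ g ⟨ g⁻ ⟨ gen s ⟨ g ⟨ k ⟩ ⟩ ⟩ ⟩ ⟩         ≡⟨ cong (λ z → gen s ⟨ g ⟨ z ⟩ ⟩) (sym (t-⟨⟩ k)) ⟩
    gen s ⟨ g ⟨ t ⟨ k ⟩ ⟩ ⟩                          ≡⟨ sym (·-⟨⟩ (gen s) g _) ⟩
    prodW (s ∷ ss) ⟨ t ⟨ k ⟩ ⟩                       ≡⟨ sym (·-⟨⟩ (prodW (s ∷ ss)) t k) ⟩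
    (prodW (s ∷ ss) · t) ⟨ k ⟩                       ∎
    where open ≡-Reasoning

-- Reflections, lengths and Bruhat steps

reflection-refl : {t : Elt n} → Reflection t → ∃ λ x → ∃ λ y → x Fin.< y × IsRefl t x y
reflection-refl {n} (ws , s , refl) with gen-refl s
... | a , b , adj , r = ordered (<-cmp x y)
  where
  t : Elt n
  t = prodW (ws ++ s ∷ reverse ws)
  x y : Idx n
  x = prodW ws ⟨ a ⟩
  y = prodW ws ⟨ b ⟩
  isr : IsRefl t x y
  isr = refl-conj (prodW (reverse ws)) (prodW ws) (prodW-signed (reverse ws)) (prodW-reverse ws)
      (prodW-reverse′ ws) (conjugate-⟨⟩ ws s (reverse ws))
          (subst₂ (IsRefl (gen s)) (sym (prodW-reverse ws a)) (sym (prodW-reverse ws b)) r)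
  ordered : _ → _
  ordered (tri< x<y _ _) = x , y , x<y , isr
  ordered (tri> _ _ y<x) = y , x , y<x , refl-sym isr
  ordered (tri≈ _ e _) = ⊥-elim (<-irrefl (cong toℕ a≡b) (≤-reflexive (sym adj)))
    where
    a≡b : a ≡ b
    a≡b = trans (sym (prodW-reverse ws a)) (trans (cong (prodW (reverse ws) ⟨_⟩) e) (prodW-reverse ws b))

·-refl-cancel : {u t : Elt n} {x y : Idx n} → IsRefl t x y → (u · t) · t ≡ u
·-refl-cancel {u = u} {t} r = Elt-ext λ k →
  trans (·-⟨⟩ (u · t) t k) (trans (·-⟨⟩ u t _) (cong (u ⟨_⟩) (refl-involutive r k)))

·-refl-injective : (u : Elt n) {t : Elt n} {x y : Idx n} → IsRefl t x y → Inj u → Inj (u · t)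
·-refl-injective u {t} r u-inj {a} {b} e = refl-injective r
    (u-inj (trans (sym (·-⟨⟩ u t a)) (trans e (·-⟨⟩ u t b))))

·-refl-signed : (u : Elt n) {t : Elt n} {x y : Idx n} → IsRefl t x y → Signed u → Signed (u · t)
·-refl-signed u {t} r u-signed k = trans (·-⟨⟩ u t _) (trans (cong (u ⟨_⟩) (refl-signed r k))
  (trans (u-signed _) (cong opposite (sym (·-⟨⟩ u t k)))))

-- From `x < y` follows ȳ < x̄, so the least moved position is the smaller of `x` and ȳ; at either
-- one the ascent raises the value. This makes the lexicographic order a termination measure both
-- for sorting to the identity and for climbing to `w`.
first-change : {v t : Elt n} {x y : Idx n} → IsRefl t x y → Signed v → x Fin.< y → v ⟨ x ⟩ Fin.< v ⟨ y ⟩ →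
  ∃ λ p → (∀ k → k Fin.< p → v ⟨ k ⟩ ≡ (v · t) ⟨ k ⟩) × v ⟨ p ⟩ Fin.< (v · t) ⟨ p ⟩
first-change {v = v} {t} {x} {y} r v-signed x<y vx<vy with x ≤? opposite y
... | yes x≤ȳ = x , same , subst (v ⟨ x ⟩ Fin.<_) (sym (trans (·-⟨⟩ v t x) (cong (v ⟨_⟩) (to r)))) vx<vy
  where
  same : ∀ k → k Fin.< x → v ⟨ k ⟩ ≡ (v · t) ⟨ k ⟩
  same k k<x = sym (trans (·-⟨⟩ v t k) (cong (v ⟨_⟩) (fixes r
    (λ e → <-irrefl (cong toℕ e) k<x)
    (λ e → <-irrefl (cong toℕ e) (<-trans k<x x<y))
    (λ e → <-irrefl (cong toℕ e) (<-trans (<-≤-trans k<x x≤ȳ) (opposite-< x<y)))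
    (λ e → <-irrefl (cong toℕ e) (<-≤-trans k<x x≤ȳ)))))
... | no x≰ȳ = opposite y , same , subst₂ Fin._<_ (sym (v-signed y)) (sym at-ȳ≡) (opposite-< vx<vy)
  where
  ȳ<x : opposite y Fin.< x
  ȳ<x = ≰⇒> x≰ȳ
  at-ȳ≡ : (v · t) ⟨ opposite y ⟩ ≡ opposite (v ⟨ x ⟩)
  at-ȳ≡ = trans (·-⟨⟩ v t _) (trans (cong (v ⟨_⟩) (bar-fro r)) (v-signed x))
  same : ∀ k → k Fin.< opposite y → v ⟨ k ⟩ ≡ (v · t) ⟨ k ⟩
  same k k<ȳ = sym (trans (·-⟨⟩ v t k) (cong (v ⟨_⟩) (fixes r
    (λ e → <-irrefl (cong toℕ e) (<-trans k<ȳ ȳ<x))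
    (λ e → <-irrefl (cong toℕ e) (<-trans k<ȳ (<-trans ȳ<x x<y)))
    (λ e → <-irrefl (cong toℕ e) (<-trans k<ȳ (opposite-< x<y)))
    (λ e → <-irrefl (cong toℕ e) k<ȳ))))

lex-< : ∀ {A : Set} {_≺_ : A → A → Set} {m} (us vs : Vec A m) (p : Fin m) →
  (∀ k → k Fin.< p → lookup us k ≡ lookup vs k) → lookup us p ≺ lookup vs p → Lex-< _≡_ _≺_ us vs
lex-< (u ∷ us) (v ∷ vs) Fin.zero _ lt = this lt refl
lex-< (u ∷ us) (v ∷ vs) (Fin.suc p) same lt =
  next (same Fin.zero (s≤s z≤n)) (lex-< us vs p (λ k k<p → same (Fin.suc k) (s≤s k<p)) lt)

lex-wf : ∀ {A : Set} {_≺_ : A → A → Set} → WellFounded _≺_ → ∀ {m} → WellFounded (Lex-< _≡_ _≺_ {m} {m})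
lex-wf wf = Lex.<-wellFounded trans (λ { refl z → z }) wf

-- Strict growth gives `k ≤ v k` by counting up from the bottom; the opposite inequality is this one
-- at the negated index.
ascending-everywhere : {v : Elt n} → Signed v → (∀ {a b} → toℕ b ≡ suc (toℕ a) → v ⟨ a ⟩ Fin.< v ⟨ b ⟩) →
    v ≡ idE
ascending-everywhere {n} {v} v-signed mono = Elt-ext λ k →
    trans (toℕ-injective (≤-antisym (below k) (above _ k refl))) (sym (idE-⟨⟩ n k))
  where
  above : ∀ m (k : Idx n) → toℕ k ≡ m → m ℕ.≤ toℕ (v ⟨ k ⟩)
  above zero k _ = z≤n
  above (suc m) k k≡ = ≤-<-trans (above m k′ k′≡) (mono (trans k≡ (cong suc (sym k′≡))))
    where
    m<N : m ℕ.< n ℕ.+ n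
    m<N = <-trans (subst (m ℕ.<_) (sym k≡) ≤-refl) (toℕ<n k)
    k′ = fromℕ< m<N
    k′≡ : toℕ k′ ≡ m
    k′≡ = toℕ-fromℕ< m<N
  below : ∀ k → toℕ (v ⟨ k ⟩) ℕ.≤ toℕ k
  below k = subst₂ ℕ._≤_ (cong toℕ (opposite-involutive (v ⟨ k ⟩))) (cong toℕ (opposite-involutive k))
    (opposite-≤ (subst (opposite k Fin.≤_) (v-signed k) (above _ (opposite k) refl)))

generated : (v : Elt n) → Inj v → Signed v → ∃ λ ss → prodW ss ≡ v
generated {n} v = go v (lex-wf <-wellFounded (Elt.oneLine v))
  where
  go : ∀ (v : Elt n) → Acc (Lex-< _≡_ Fin._<_) (Elt.oneLine v) → Inj v → Signed v → ∃ λ ss → prodW ss ≡ v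
  go v (acc rs) v-inj v-signed
    with any? (λ a → any? (λ b → (toℕ b ℕ.≟ suc (toℕ a)) ×-dec (v ⟨ b ⟩ <? v ⟨ a ⟩)))
  ... | no none = [] , sym (ascending-everywhere v-signed λ {a} {b} adj → ≤∧≢⇒<
      (≮⇒≥ λ lt → none (a , b , adj , lt))
          (λ e → <-irrefl (cong toℕ (v-inj (toℕ-injective e))) (≤-reflexive (sym adj))))
  ... | yes (a , b , adj , desc) with adjacent-gen {n} adj
  -- `first-change` is applied to `v · gen s`, where the pair is an ascent. A second multiplication
  -- by `gen s` returns `v`, so `v · gen s` is lexicographically smaller than `v`.
  ...   | s , r with first-change {v = v · gen s} r (·-refl-signed v r v-signed) (≤-reflexive (sym adj))
                       (subst₂ Fin._<_ (sym (trans (·-⟨⟩ v (gen s) a) (cong (v ⟨_⟩) (to r))))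
                           (sym (trans (·-⟨⟩ v (gen s) b) (cong (v ⟨_⟩) (fro r)))) desc)
  ...     | p , same , lt
        with go (v · gen s) (rs (lex-< _ _ p (λ k k<p → trans (same k k<p) (cong (_⟨ k ⟩) back))
            (subst (λ z → (v · gen s) ⟨ p ⟩ Fin.< z ⟨ p ⟩) back lt)))
                (·-refl-injective v r v-inj) (·-refl-signed v r v-signed)
    where
    back : (v · gen s) · gen s ≡ v
    back = ·-refl-cancel r
  ...       | ss , eq = ss ++ [ s ] , trans (Elt-ext λ k → trans (prodW-++ ss [ s ] k)
                (trans (cong₂ _⟨_⟩ eq (prodW-single s k)) (sym (·-⟨⟩ (v · gen s) (gen s) k)))) (·-refl-cancel r)

-- The first letter is an involution and can be moved to the other side, which reduces the question
-- to words one letter shorter. Decidability is what turns an arbitrary word into a shortest one, as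
-- `HasLength` demands.
word? : (k : ℕ) (w : Elt n) → Dec (∃ λ ws → length ws ≡ k × prodW ws ≡ w)
word? zero w = map′ (λ e → [] , refl , e) (λ { ([] , _ , e) → e }) (idE ≟E w)
word? {n} (suc k) w = map′ fwd bwd (any? λ i → word? k (gen i · w))
  where
  cancel : ∀ i (u : Elt n) → gen i · (gen i · u) ≡ u
  cancel i u = Elt-ext λ k → trans (·-⟨⟩ (gen i) (gen i · u) k)
      (trans (cong (gen i ⟨_⟩) (·-⟨⟩ (gen i) u k)) (gen-involutive i _))
  fwd : (∃ λ i → ∃ λ ws → length ws ≡ k × prodW ws ≡ gen i · w) → ∃ λ ws → length ws ≡ suc k × prodW ws ≡ w
  fwd (i , ws , len , e) = i ∷ ws , cong suc len , trans (cong (gen i ·_) e) (cancel i w)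
  bwd : (∃ λ ws → length ws ≡ suc k × prodW ws ≡ w) → ∃ λ i → ∃ λ ws → length ws ≡ k × prodW ws ≡ gen i · w
  bwd (i ∷ ws , len , e) = i , ws , suc-injective len , trans (sym (cancel i _)) (cong (gen i ·_) e)

ℕ-least : ∀ {P : ℕ → Set} → Decidable P → ∀ m → P m → ∃ λ k → P k × (∀ j → P j → k ℕ.≤ j)
ℕ-least P? zero p = zero , p , λ _ _ → z≤n
ℕ-least P? (suc m) p with P? zero
... | yes p₀ = zero , p₀ , λ _ _ → z≤n
... | no ¬p₀ with ℕ-least (P? ∘ suc) m p
...   | k , pk , min = suc k , pk , λ { zero p₀ → ⊥-elim (¬p₀ p₀) ; (suc j) pj → s≤s (min j pj) }

hasLength : {w : Elt n} (ss : List (Fin n)) → prodW ss ≡ w → ∃ λ k → HasLength w k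
hasLength {w = w} ss e with ℕ-least (λ k → word? k w) (length ss) (ss , refl , e)
... | k , word , min = k , word , λ ws e′ → min (length ws) (ws , refl , e′)

w₀ : Elt n
w₀ = mkE (tabulate opposite)

w₀-⟨⟩ : (k : Idx n) → w₀ {n} ⟨ k ⟩ ≡ opposite k
w₀-⟨⟩ = lookup∘tabulate _

-- The element `w₀` inverts every pair, so `exchange` on any word for it produces the reflection of
-- the given pair as a conjugate of a generator; no explicit conjugating word has to be written
-- down.
pair-reflection : {x y : Idx n} → x Fin.< y → ∃ λ (t : Elt n) → Reflection t × IsRefl t x y
pair-reflection {n} {x} {y} x<y
  with generated {n} w₀ (λ {a} {b} e → opposite-injective (trans (sym (w₀-⟨⟩ {n} a)) (trans e (w₀-⟨⟩ {n} b))))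
                    (λ k → trans (w₀-⟨⟩ {n} _) (cong opposite (sym (w₀-⟨⟩ {n} k))))
... | ss , e with exchange ss x<y (subst (λ u → u ⟨ y ⟩ Fin.< u ⟨ x ⟩) (sym e)
                    (subst₂ Fin._<_ (sym (w₀-⟨⟩ {n} y)) (sym (w₀-⟨⟩ {n} x)) (opposite-< x<y)))
...   | _ , t , _ , isr , r , _ = t , isr , r

-- A shortest word for `w` loses one letter under `exchange`. The reflection found there is `t`
-- because a reflection is determined by its pair.
refl-shortens : {w t : Elt n} {x y : Idx n} {a b : ℕ} → IsRefl t x y → x Fin.< y → w ⟨ y ⟩ Fin.< w ⟨ x ⟩ →
  HasLength (w · t) a → HasLength w b → a ℕ.< b
refl-shortens {w = w} {t} {x} {y} {a} r x<y inv (_ , min) ((ss , refl , refl) , _) with exchange ss x<y inv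
... | ss′ , t′ , len , _ , r′ , e = subst (a ℕ.<_) len
    (s≤s (min ss′ (trans e (cong (prodW ss ·_) (refl-unique r′ r)))))

ascent-step : {v t : Elt n} {x y : Idx n} → Inj v → Signed v → Reflection t → IsRefl t x y →
  x Fin.< y → v ⟨ x ⟩ Fin.< v ⟨ y ⟩ → BruhatStep v (v · t)
ascent-step {n} {v} {t} {x} {y} v-inj v-signed isr r x<y vx<vy
  with generated v v-inj v-signed | generated (v · t) (·-refl-injective v r v-inj) (·-refl-signed v r v-signed)
... | ss , e | ss′ , e′ with hasLength ss e | hasLength ss′ e′
... | a , ha | b , hb = t , isr , refl , a , b , ha , hb ,
  refl-shortens {w = v · t} r x<y
    (subst₂ Fin._<_ (sym (trans (·-⟨⟩ v t y) (cong (v ⟨_⟩) (fro r))))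
        (sym (trans (·-⟨⟩ v t x) (cong (v ⟨_⟩) (to r)))) vx<vy)
    (subst (λ u → HasLength u a) (sym (·-refl-cancel r)) ha) hb

step-ascent : {u w : Elt n} → BruhatStep u w →
  ∃ λ t → ∃ λ x → ∃ λ y → IsRefl t x y × u · t ≡ w × Signed u × x Fin.< y × u ⟨ x ⟩ Fin.< u ⟨ y ⟩
step-ascent {u = u} (t , isr , refl , a , b , ha , hb , a<b) with reflection-refl isr | ha
-- The length of `u` comes with a word for `u`; this is the source of both its signedness and its
-- injectivity. A descent at the pair would make `u · t` shorter than `u`.
... | x , y , x<y , r | ((ss , _ , refl) , _) = t , x , y , r , refl , prodW-signed ss , x<y , ordered
    (<-cmp (u ⟨ x ⟩) (u ⟨ y ⟩))
  where
  ordered : _ → u ⟨ x ⟩ Fin.< u ⟨ y ⟩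
  ordered (tri< lt _ _) = lt
  ordered (tri≈ _ e _) = ⊥-elim (<-irrefl
      (cong toℕ (trans (sym (prodW-reverse ss x))
      (trans (cong (prodW (reverse ss) ⟨_⟩) e) (prodW-reverse ss y)))) x<y)
  ordered (tri> _ _ gt) = ⊥-elim (<-irrefl refl (<-trans a<b (refl-shortens {w = u} r x<y gt hb ha)))

-- Boolean tests, counting, and inversions under a transposition

T∧⁻ : ∀ {x y} → T (x ∧ y) → T x × T y
T∧⁻ = Equivalence.to T-∧

T∧⁺ : ∀ {x y} → T x → T y → T (x ∧ y)
T∧⁺ p q = Equivalence.from T-∧ (p , q)

T-not⁺ : ∀ {x} → ¬ T x → T (not x)
T-not⁺ {Bool.true} ¬t = ⊥-elim (¬t _)
T-not⁺ {Bool.false} _ = _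

T-not⁻ : ∀ {x} → T (not x) → ¬ T x
T-not⁻ {Bool.false} _ ()

allFin⁻ : ∀ {m} {p : Fin m → Bool} → T (all p (allFin m)) → ∀ k → T (p k)
allFin⁻ {m} {p} h k = All.lookup (Allₚ.all⁺ p (allFin m) h) (∈-allFin k)

allFin⁺ : ∀ {m} {p : Fin m → Bool} → (∀ k → T (p k)) → T (all p (allFin m))
allFin⁺ {m} {p} h = Allₚ.all⁻ p {xs = allFin m} (All.tabulate λ {k} _ → h k)

perm⁻ : ∀ {n} (v : Elt n) → T (isPermᵇ v) → Inj v
perm⁻ v h {i} {j} eq
  with Equivalence.to (T-∨ {not ((v ⟨ i ⟩) == (v ⟨ j ⟩))})
      (allFin⁻ {p = λ j → not ((v ⟨ i ⟩) == (v ⟨ j ⟩)) ∨ (i == j)} (allFin⁻ h i) j)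
... | inj₁ ne = ⊥-elim (T-not⁻ {(v ⟨ i ⟩) == (v ⟨ j ⟩)} ne (fromWitness eq))
... | inj₂ i≡j = toWitness {a? = i ≟ j} i≡j

perm⁺ : ∀ {n} (v : Elt n) → Inj v → T (isPermᵇ v)
perm⁺ v v-inj = allFin⁺ λ i → allFin⁺ λ j → pair i j
  where
  pair : ∀ i j → T (not ((v ⟨ i ⟩) == (v ⟨ j ⟩)) ∨ (i == j))
  pair i j with v ⟨ i ⟩ ≟ v ⟨ j ⟩
  ... | no _ = _
  ... | yes eq = fromWitness (v-inj eq)

signed⁻ : ∀ {n} (v : Elt n) → T (isSignedᵇ v) → Signed v
signed⁻ v h k = toWitness (allFin⁻ h k)

unique-map : ∀ {A B : Set} {f : A → B} {xs : List A} →
  (∀ {x y} → x ∈ xs → y ∈ xs → f x ≡ f y → x ≡ y) → Unique xs → Unique (map f xs)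
unique-map {xs = []} _ [] = []
unique-map {f = f} {x ∷ xs} inj (x∉ ∷ uxs) = All.tabulate fresh ∷ unique-map
    (λ p q → inj (there p) (there q)) uxs
  where
  fresh : ∀ {z} → z ∈ map f xs → f x ≢ z
  fresh z∈ eq with ∈-map⁻ f z∈
  ... | y , y∈ , refl = All.lookup x∉ y∈ (inj (here refl) (there y∈) eq)

count-< : ∀ {A : Set} {p q : A → Bool} {xs : List A} (φ : A → A) → Unique xs → (∀ x → x ∈ xs) →
  (∀ {x} → T (p x) → T (q (φ x))) → (∀ {x y} → T (p x) → T (p y) → φ x ≡ φ y → x ≡ y) →
  ∀ {z} → T (q z) → (∀ {x} → T (p x) → φ x ≢ z) → length (filterᵇ p xs) ℕ.< length (filterᵇ q xs)
count-< {p = p} {q} {xs} φ uxs ∈xs maps inj {z} qz avoids =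
  subst (ℕ._< length (filterᵇ q xs)) (length-map φ (filterᵇ p xs))
    (unique-⊆⇒length≤ (All.tabulate fresh ∷ unique-map (λ x∈ y∈ → inj (p∈ x∈) (p∈ y∈))
        (Uniqueₚ.filter⁺ (T? ∘ p) uxs)) sub)
  where
  p∈ : ∀ {x} → x ∈ filterᵇ p xs → T (p x)
  p∈ x∈ = proj₂ (∈-filter⁻ (T? ∘ p) {xs = xs} x∈)
  fresh : ∀ {y} → y ∈ map φ (filterᵇ p xs) → z ≢ y
  fresh y∈ eq with ∈-map⁻ φ y∈
  ... | x , x∈ , refl = avoids (p∈ x∈) (sym eq)
  sub : ∀ {y} → y ∈ z ∷ map φ (filterᵇ p xs) → y ∈ filterᵇ q xs
  sub (here refl) = ∈-filter⁺ (T? ∘ q) (∈xs z) qz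
  sub (there y∈) with ∈-map⁻ φ y∈
  ... | x , x∈ , refl = ∈-filter⁺ (T? ∘ q) (∈xs (φ x)) (maps (p∈ x∈))

count-≡1 : ∀ {A : Set} {p : A → Bool} {xs : List A} → Unique xs → (∀ {x y} → T (p x) → T (p y) → x ≡ y) →
  ∀ {x} → x ∈ xs → T (p x) → length (filterᵇ p xs) ≡ 1
count-≡1 {p = p} {xs} uxs same {x} x∈ px = ≤-antisym
  (unique-⊆⇒length≤ {ys = [ x ]} (Uniqueₚ.filter⁺ (T? ∘ p) uxs)
    (λ y∈ → here (same (proj₂ (∈-filter⁻ (T? ∘ p) {xs = xs} y∈)) px)))
  (unique-⊆⇒length≤ {xs = [ x ]} ([] ∷ []) (λ { (here refl) → ∈-filter⁺ (T? ∘ p) x∈ px }))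

concatMap-pairs : ∀ {A B : Set} (xs : List A) (ys : List B) →
  cartesianProduct xs ys ≡ concatMap (λ x → map (λ y → (x , y)) ys) xs
concatMap-pairs [] ys = refl
concatMap-pairs (x ∷ xs) ys = cong (map (x ,_) ys ++_) (concatMap-pairs xs ys)

-- Exchanging a non-inverted pair a < b creates an inversion: an inversion (i , j) of w goes to its image under
-- the transposition when that is increasing and stays put otherwise; (a , b) is not hit.
module SwapInversions {n : ℕ} (w : Elt n) {a b : Idx n} (a<b : a Fin.< b) (wa<wb : w ⟨ a ⟩ Fin.< w ⟨ b ⟩) where
  private
    σ : Idx n → Idx n
    σ k = swapE {n} a b ⟨ k ⟩

    u : Elt n
    u = w · swapE a b

    idx : List (Idx n)
    idx = allFin (M n)

    Pair : Set
    Pair = Idx n × Idx n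

    Inv : Elt n → Pair → Set
    Inv v (i , j) = i Fin.< j × v ⟨ j ⟩ Fin.< v ⟨ i ⟩

    data At : Idx n → Idx n → Set where
      at-a  : At a b
      at-b  : At b a
      apart : ∀ {k} → At k k

    at : ∀ k → At k (σ k)
    at k with k ≟ a
    ... | yes refl = subst (At a) (sym (swapE-left {n} a b)) at-a
    ... | no k≢a with k ≟ b
    ...   | yes refl = subst (At b) (sym (swapE-right {n} a b)) at-b
    ...   | no k≢b = subst (At k) (sym (swapE-other {n} k≢a k≢b)) apart

    σσ : ∀ k → σ (σ k) ≡ k
    σσ = swapE-involutive {n} a b

    u-σ : ∀ k → u ⟨ σ k ⟩ ≡ w ⟨ k ⟩
    u-σ k = trans (·-⟨⟩ w (swapE a b) (σ k)) (cong (w ⟨_⟩) (σσ k))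

    stays : ∀ {i j i′ j′} → At i i′ → At j j′ → i Fin.< j → w ⟨ j ⟩ Fin.< w ⟨ i ⟩ → ¬ (i′ Fin.< j′) →
        w ⟨ j′ ⟩ Fin.< w ⟨ i′ ⟩
    stays at-a at-a i<j _ _ = ⊥-elim (<-irrefl refl i<j)
    stays at-a at-b _ wj<wi _ = ⊥-elim (<-irrefl refl (<-trans wa<wb wj<wi))
    stays at-a apart _ wj<wi _ = <-trans wj<wi wa<wb
    stays at-b at-a i<j _ _ = ⊥-elim (<-irrefl refl (<-trans a<b i<j))
    stays at-b at-b i<j _ _ = ⊥-elim (<-irrefl refl i<j)
    stays at-b apart i<j _ ≮ = ⊥-elim (≮ (<-trans a<b i<j))
    stays apart at-a i<j _ ≮ = ⊥-elim (≮ (<-trans i<j a<b))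
    stays apart at-b _ wj<wi _ = <-trans wa<wb wj<wi
    stays apart apart _ wj<wi _ = wj<wi

    φ : Pair → Pair
    φ (i , j) with σ i <? σ j
    ... | yes _ = σ i , σ j
    ... | no _ = i , j

    φ-inv : ∀ p → Inv w p → Inv u (φ p)
    φ-inv (i , j) (i<j , wj<wi) with σ i <? σ j
    ... | yes lt = lt , subst₂ Fin._<_ (sym (u-σ j)) (sym (u-σ i)) wj<wi
    ... | no ≮ = i<j , subst₂ Fin._<_ (sym (·-⟨⟩ w (swapE a b) j)) (sym (·-⟨⟩ w (swapE a b) i))
        (stays (at i) (at j) i<j wj<wi ≮)

    σ-inj : ∀ {i j} → σ i ≡ σ j → i ≡ j
    σ-inj {i} {j} e = trans (sym (σσ i)) (trans (cong σ e) (σσ j))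

    φ-injective : ∀ p q → Inv w p → Inv w q → φ p ≡ φ q → p ≡ q
    φ-injective (i , j) (k , l) (i<j , _) (k<l , _) eq with σ i <? σ j | σ k <? σ l
    ... | yes _ | yes _ = cong₂ _,_ (σ-inj (cong proj₁ eq)) (σ-inj (cong proj₂ eq))
    ... | no _ | no _ = eq
    ... | yes _ | no ≮ = ⊥-elim (≮ (subst₂ Fin._<_ (trans (sym (σσ i)) (cong σ (cong proj₁ eq)))
        (trans (sym (σσ j)) (cong σ (cong proj₂ eq))) i<j))
    ... | no ≮ | yes _ = ⊥-elim (≮ (subst₂ Fin._<_ (trans (sym (σσ k)) (cong σ (sym (cong proj₁ eq))))
        (trans (sym (σσ l)) (cong σ (sym (cong proj₂ eq)))) k<l))

    φ-avoids : ∀ p → Inv w p → φ p ≢ (a , b)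
    φ-avoids (i , j) (i<j , wj<wi) eq with σ i <? σ j
    φ-avoids (i , j) (i<j , wj<wi) refl | no _ = <-irrefl refl (<-trans wa<wb wj<wi)
    ... | yes _ = <-irrefl refl (<-trans a<b (subst₂ Fin._<_
        (trans (sym (σσ i)) (trans (cong σ (cong proj₁ eq)) (swapE-left {n} a b)))
        (trans (sym (σσ j)) (trans (cong σ (cong proj₂ eq)) (swapE-right {n} a b))) i<j))

    inv⁻ : ∀ {i j} (v : Elt n) → T ((i <F j) ∧ ((v ⟨ j ⟩) <F (v ⟨ i ⟩))) → Inv v (i , j)
    inv⁻ v h = <ᵇ⇒< _ _ (proj₁ (T∧⁻ h)) , <ᵇ⇒< _ _ (proj₂ (T∧⁻ h))

    inv⁺ : ∀ {i j} (v : Elt n) → Inv v (i , j) → T ((i <F j) ∧ ((v ⟨ j ⟩) <F (v ⟨ i ⟩)))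
    inv⁺ v (p , q) = T∧⁺ (<⇒<ᵇ p) (<⇒<ᵇ q)

  invA-swap : invA w ℕ.< invA (w · swapE a b)
  invA-swap = count-< {xs = concatMap (λ i → map (λ j → (i , j)) idx) idx} φ
    (subst Unique (concatMap-pairs idx idx) (Uniqueₚ.cartesianProduct⁺ (Uniqueₚ.allFin⁺ _) (Uniqueₚ.allFin⁺ _)))
    (λ { (i , j) → subst ((i , j) ∈_) (concatMap-pairs idx idx)
        (∈-cartesianProduct⁺ (∈-allFin i) (∈-allFin j)) })
    (λ {p} h → inv⁺ u (φ-inv p (inv⁻ w h)))
    (λ {p} {q} h h′ → φ-injective p q (inv⁻ w h) (inv⁻ w h′))
    {z = a , b}
    (inv⁺ u (a<b , subst₂ Fin._<_ (sym (trans (·-⟨⟩ w (swapE a b) b) (cong (w ⟨_⟩) (swapE-right {n} a b))))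
                                  (sym (trans (·-⟨⟩ w (swapE a b) a)
                                      (cong (w ⟨_⟩) (swapE-left {n} a b)))) wa<wb))
    (λ {p} h → φ-avoids p (inv⁻ w h))

-- Edges, paths and wires of a network

module Net {n t : ℕ} (I : Intervals n t) where
  open Network I public

  Cut : Fin t → Idx n → Set
  Cut k x = c I k Fin.< d I k × c I k Fin.≤ x × x Fin.≤ d I k

  cut⁻ : ∀ {k x} → T (cut k x) → Cut k x
  cut⁻ {k} {x} h with T∧⁻ {c I k <F d I k} h
  ... | p , q with T∧⁻ {c I k ≤F x} q
  ...   | r , s = <ᵇ⇒< _ _ p , ≤ᵇ⇒≤ _ _ r , ≤ᵇ⇒≤ _ _ s

  cut⁺ : ∀ {k x} → Cut k x → T (cut k x)
  cut⁺ (p , q , r) = T∧⁺ (<⇒<ᵇ p) (T∧⁺ (≤⇒≤ᵇ q) (≤⇒≤ᵇ r))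

  First : Idx n → Fin t → Set
  First i k = Cut k i × (∀ k′ → k′ Fin.< k → ¬ Cut k′ i)

  Last : Fin t → Idx n → Set
  Last k j = Cut k j × (∀ k′ → k Fin.< k′ → ¬ Cut k′ j)

  Next : Fin t → Fin t → Set
  Next a b = a Fin.< b × (∃ λ x → Cut a x × Cut b x × (∀ k → a Fin.< k → k Fin.< b → ¬ Cut k x))

  edge-src-mid⁻ : ∀ {i k} → T (edge (src i) (mid k)) → First i k
  edge-src-mid⁻ {i} {k} h with T∧⁻ {cut k i} h
  ... | p , q = cut⁻ p , λ k′ lt cu → T-not⁻ {(k′ <F k) ∧ cut k′ i} (allFin⁻ q k′) (T∧⁺ (<⇒<ᵇ lt) (cut⁺ cu))

  edge-src-mid⁺ : ∀ {i k} → First i k → T (edge (src i) (mid k))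
  edge-src-mid⁺ {i} {k} (cu , none) = T∧⁺ (cut⁺ cu) (allFin⁺ λ k′ → T-not⁺ {(k′ <F k) ∧ cut k′ i} λ h →
    none k′ (<ᵇ⇒< _ _ (proj₁ (T∧⁻ {k′ <F k} h))) (cut⁻ (proj₂ (T∧⁻ {k′ <F k} h))))

  edge-src-snk⁻ : ∀ {i j} → T (edge (src i) (snk j)) → i ≡ j × (∀ k → ¬ Cut k i)
  edge-src-snk⁻ {i} {j} h with T∧⁻ {i == j} h
  ... | p , q = toWitness p , λ k cu → T-not⁻ {cut k i} (allFin⁻ q k) (cut⁺ cu)

  edge-src-snk⁺ : ∀ {i} → (∀ k → ¬ Cut k i) → T (edge (src i) (snk i))
  edge-src-snk⁺ {i} none = T∧⁺ (fromWitness {a? = i ≟ i} refl) (allFin⁺ λ k → T-not⁺ {cut k i} (none k ∘ cut⁻))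

  edge-mid-mid⁻ : ∀ {a b} → T (edge (mid a) (mid b)) → Next a b
  edge-mid-mid⁻ {a} {b} h with T∧⁻ {a <F b} h
  ... | p , q with satisfied (Anyₚ.any⁻ _ positions q)
  ...   | x , r with T∧⁻ {cut a x} r
  ...     | ca , s with T∧⁻ {cut b x} s
  ...       | cb , none = <ᵇ⇒< _ _ p , x , cut⁻ ca , cut⁻ cb ,
    λ k a<k k<b cu → T-not⁻ {(a <F k) ∧ (k <F b) ∧ cut k x} (allFin⁻ none k)
        (T∧⁺ (<⇒<ᵇ a<k) (T∧⁺ (<⇒<ᵇ k<b) (cut⁺ cu)))

  edge-mid-mid⁺ : ∀ {a b} → Next a b → T (edge (mid a) (mid b))
  edge-mid-mid⁺ {a} {b} (a<b , x , ca , cb , none) = T∧⁺ (<⇒<ᵇ a<b) (Anyₚ.any⁺ _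
    (Any.map (λ { refl → T∧⁺ (cut⁺ ca)
        (T∧⁺ (cut⁺ cb) (allFin⁺ λ k → T-not⁺ {(a <F k) ∧ (k <F b) ∧ cut k x} (clear k))) }) (∈-allFin x)))
    where
    clear : ∀ k → ¬ T ((a <F k) ∧ (k <F b) ∧ cut k x)
    clear k h with T∧⁻ {a <F k} h
    ... | p , q with T∧⁻ {k <F b} q
    ...   | r , s = none k (<ᵇ⇒< _ _ p) (<ᵇ⇒< _ _ r) (cut⁻ s)

  edge-mid-snk⁻ : ∀ {k j} → T (edge (mid k) (snk j)) → Last k j
  edge-mid-snk⁻ {k} {j} h with T∧⁻ {cut k j} h
  ... | p , q = cut⁻ p , λ k′ lt cu → T-not⁻ {(k <F k′) ∧ cut k′ j} (allFin⁻ q k′) (T∧⁺ (<⇒<ᵇ lt) (cut⁺ cu))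

  edge-mid-snk⁺ : ∀ {k j} → Last k j → T (edge (mid k) (snk j))
  edge-mid-snk⁺ {k} {j} (cu , none) = T∧⁺ (cut⁺ cu) (allFin⁺ λ k′ → T-not⁺ {(k <F k′) ∧ cut k′ j} λ h →
    none k′ (<ᵇ⇒< _ _ (proj₁ (T∧⁻ {k <F k′} h))) (cut⁻ (proj₂ (T∧⁻ {k <F k′} h))))

  Path : Vtx n t → List (Fin t) → Idx n → Set
  Path v ks j = T (valid v ks j)

  uncons : ∀ {v k ks j} → Path v (k ∷ ks) j → T (edge v (mid k)) × Path (mid k) ks j
  uncons {v} {k} = T∧⁻ {edge v (mid k)}

  Reach : Idx n → Idx n → Set
  Reach i j = ∃ λ ks → Path (src i) ks j

  -- Unlike Path, this records the position after every stage, so that two routes exchanging their order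
  -- must both pass through the vertex of the stage where that happens.
  data Wire (s : ℕ) (x y : Idx n) : Set where
    done : s ≡ t → x ≡ y → Wire s x y
    stay : (k : Fin t) → toℕ k ≡ s → ¬ Cut k x → Wire (suc s) x y → Wire s x y
    move : (k : Fin t) → toℕ k ≡ s → ∀ {x′} → Cut k x → Cut k x′ → Wire (suc s) x′ y → Wire s x y

  straight : ∀ {s e x y} → s ℕ.≤ e → e ℕ.≤ t → (∀ k → s ℕ.≤ toℕ k → toℕ k ℕ.< e → ¬ Cut k x) → Wire e x y →
      Wire s x y
  straight {s} {zero} z≤n _ _ r = r
  straight {s} {suc e} s≤1+e e<t none r with m≤n⇒m<n∨m≡n s≤1+e
  ... | inj₂ refl = r
  ... | inj₁ (s≤s s≤e) = straight s≤e (<⇒≤ e<t) (λ k s≤k k<e → none k s≤k (m≤n⇒m≤1+n k<e))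
          (stay k k≡e (none k (≤-trans s≤e (≤-reflexive (sym k≡e))) (s≤s (≤-reflexive k≡e))) r)
    where
    k : Fin t
    k = fromℕ< e<t
    k≡e : toℕ k ≡ e
    k≡e = toℕ-fromℕ< e<t

  path⇒wire-mid : ∀ {a} ks {y} → Path (mid a) ks y → ∃ λ x → Cut a x × Wire (suc (toℕ a)) x y
  path⇒wire-mid {a} [] {y} h with edge-mid-snk⁻ {a} {y} h
  ... | cu , none = y , cu , straight (toℕ<n a) ≤-refl (λ k a<k _ → none k a<k) (done refl refl)
  path⇒wire-mid {a} (b ∷ ks) {y} h with uncons {mid a} {b} {ks} h
  ... | e , h′ with edge-mid-mid⁻ e | path⇒wire-mid ks h′
  ...   | a<b , x , ca , cb , none | x′ , cb′ , r =
    x , ca , straight a<b (<⇒≤ (toℕ<n b)) none (move b refl cb cb′ r)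

  reach⇒wire : ∀ {i j} → Reach i j → Wire 0 i j
  reach⇒wire {i} {j} ([] , h) with edge-src-snk⁻ {i} {j} h
  ... | i≡j , none = straight z≤n ≤-refl (λ k _ _ → none k) (done refl i≡j)
  reach⇒wire {i} (k ∷ ks , h) with uncons {src i} {k} {ks} h
  ... | e , h′ with edge-src-mid⁻ {i} {k} e | path⇒wire-mid ks h′
  ...   | ci , none | x′ , ck , r = straight z≤n (<⇒≤ (toℕ<n k)) (λ k′ _ lt → none k′ lt) (move k refl ci ck r)

  -- v is the last vertex met by wire x before stage s
  At : Vtx n t → ℕ → Idx n → Set
  At (src i) s x = x ≡ i × (∀ k → toℕ k ℕ.< s → ¬ Cut k x)
  At (mid a) s x = Cut a x × toℕ a ℕ.< s × (∀ k → a Fin.< k → toℕ k ℕ.< s → ¬ Cut k x)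
  At (snk _) s x = ⊥

  wire⇒path : ∀ v {s x y} → At v s x → Wire s x y → ∃ λ ks → Path v ks y
  wire⇒path (src i) (refl , none) (done refl refl) = [] , edge-src-snk⁺ {i} (λ k → none k (toℕ<n k))
  wire⇒path (mid a) {x = x} (ca , _ , none) (done refl refl) =
      [] , edge-mid-snk⁺ {a} {x} (ca , λ k lt → none k lt (toℕ<n k))
  wire⇒path (src i) {s} {x} (refl , none) (stay k refl ¬cu r) = wire⇒path (src i) (refl , none′) r
    where
    none′ : ∀ k′ → toℕ k′ ℕ.< suc (toℕ k) → ¬ Cut k′ x
    none′ k′ (s≤s le) with m≤n⇒m<n∨m≡n le
    ... | inj₁ lt = none k′ lt
    ... | inj₂ eq = subst (λ z → ¬ Cut z x) (sym (toℕ-injective eq)) ¬cu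
  wire⇒path (mid a) {s} {x} (ca , a<s , none) (stay k refl ¬cu r) =
      wire⇒path (mid a) (ca , m≤n⇒m≤1+n a<s , none′) r
    where
    none′ : ∀ k′ → a Fin.< k′ → toℕ k′ ℕ.< suc (toℕ k) → ¬ Cut k′ x
    none′ k′ a<k′ (s≤s le) with m≤n⇒m<n∨m≡n le
    ... | inj₁ lt = none k′ a<k′ lt
    ... | inj₂ eq = subst (λ z → ¬ Cut z x) (sym (toℕ-injective eq)) ¬cu
  wire⇒path (src i) (refl , none) (move k refl ck ck′ r)
    with wire⇒path (mid k) (ck′ , n<1+n _ , λ _ k<k″ k″≤k → ⊥-elim
        (<-irrefl refl (<-≤-trans k<k″ (ℕ.s≤s⁻¹ k″≤k)))) r
  ... | ks , p = k ∷ ks , T∧⁺ (edge-src-mid⁺ {i} {k} (ck , none)) p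
  wire⇒path (mid a) {x = x} (ca , a<k , none) (move k refl ck ck′ r)
    with wire⇒path (mid k) (ck′ , n<1+n _ , λ _ k<k″ k″≤k → ⊥-elim
        (<-irrefl refl (<-≤-trans k<k″ (ℕ.s≤s⁻¹ k″≤k)))) r
  ... | ks , p = k ∷ ks , T∧⁺ (edge-mid-mid⁺ {a} {k} (a<k , x , ca , ck , none)) p

  wire⇒reach : ∀ {i j} → Wire 0 i j → Reach i j
  wire⇒reach {i} = wire⇒path (src i) (refl , λ _ ())

  between : ∀ {k x y z} → Cut k x → Cut k z → x Fin.≤ y → y Fin.≤ z → Cut k y
  between (c<d , c≤x , _) (_ , _ , z≤d) x≤y y≤z = c<d , ≤-trans c≤x x≤y , ≤-trans y≤z z≤d

  late : ∀ {k : Fin t} {s} → toℕ k ≡ s → s ≢ t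
  late {k} refl e = <-irrefl e (toℕ<n k)

  -- If only one wire meets the vertex of a stage it cannot jump over the other, since the interval
  -- of that vertex would then contain the other position too. The order can therefore be reversed
  -- only where both meet one vertex, and there the continuations are interchanged.
  wire-crossing : ∀ {s x y X Y} → Wire s x X → Wire s y Y → x Fin.< y → Y Fin.< X → Wire s x Y × Wire s y X
  wire-crossing (done _ refl) (done _ refl) x<y Y<X = ⊥-elim (<-asym x<y Y<X)
  wire-crossing (done e _) (stay k e′ _ _) _ _ = ⊥-elim (late e′ e)
  wire-crossing (done e _) (move k e′ _ _ _) _ _ = ⊥-elim (late e′ e)
  wire-crossing (stay k e′ _ _) (done e _) _ _ = ⊥-elim (late e′ e)
  wire-crossing (move k e′ _ _ _) (done e _) _ _ = ⊥-elim (late e′ e)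
  wire-crossing (stay k e ¬ck r) (stay l e′ ¬cl q) x<y Y<X with wire-crossing r q x<y Y<X
  ... | r′ , q′ = stay k e ¬ck r′ , stay l e′ ¬cl q′
  wire-crossing {x = x} {y} (stay k refl ¬ck r) (move l e′ {y′} cl cl′ q) x<y Y<X with toℕ-injective e′
  ... | refl with x <? y′
  ...   | no x≮y′ = ⊥-elim (¬ck (between cl′ cl (≮⇒≥ x≮y′) (<⇒≤ x<y)))
  ...   | yes x<y′ with wire-crossing r q x<y′ Y<X
  ...     | r′ , q′ = stay k refl ¬ck r′ , move k refl cl cl′ q′
  wire-crossing {x = x} {y} (move k refl {x′} ck ck′ r) (stay l e′ ¬cl q) x<y Y<X with toℕ-injective e′
  ... | refl with x′ <? y
  ...   | no x′≮y = ⊥-elim (¬cl (between ck ck′ (<⇒≤ x<y) (≮⇒≥ x′≮y)))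
  ...   | yes x′<y with wire-crossing r q x′<y Y<X
  ...     | r′ , q′ = move k refl ck ck′ r′ , stay k refl ¬cl q′
  wire-crossing (move k refl ck ck′ r) (move l e′ cl cl′ q) x<y Y<X with toℕ-injective e′
  ... | refl = move k refl ck cl′ q , move k refl cl ck′ r

  reach-crossing : ∀ {x y X Y} → x Fin.< y → Y Fin.< X → Reach x X → Reach y Y → Reach x Y × Reach y X
  reach-crossing x<y Y<X p q with wire-crossing (reach⇒wire p) (reach⇒wire q) x<y Y<X
  ... | r , s = wire⇒reach r , wire⇒reach s

  -- Paths as sublists of the list of stages

  path-sorted : ∀ {v} ks {j} → Path v ks j → AllPairs Fin._<_ ks
  path-sorted [] _ = []
  path-sorted {v} (k ∷ ks) {j} h = after ks (proj₂ (uncons {v} {k} {ks} h)) ∷ path-sorted ks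
      (proj₂ (uncons {v} {k} {ks} h))
    where
    after : ∀ {k} ks → Path (mid k) ks j → All (k Fin.<_) ks
    after [] _ = []
    after {k} (l ∷ ks) h with uncons {mid k} {l} {ks} h
    ... | e , h′ = k<l ∷ All.map (<-trans k<l) (after ks h′)
      where k<l = proj₁ (edge-mid-mid⁻ {k} {l} e)

  -- Ensures that the enumeration behind `pathMatrix` misses no path, since paths visit stages in
  -- increasing order. It also makes reachability decidable.
  sorted∈sublists : ∀ (xs : List (Fin t)) {ks} → AllPairs Fin._<_ xs → AllPairs Fin._<_ ks → All (_∈ xs) ks →
      ks ∈ sublists xs
  sorted∈sublists [] {[]} _ _ _ = here refl
  sorted∈sublists [] {k ∷ ks} _ _ (() ∷ _)
  sorted∈sublists (x ∷ xs) {[]} (_ ∷ sxs) sks _ = ∈-++⁺ʳ (map (x ∷_) (sublists xs))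
      (sorted∈sublists xs sxs [] [])
  sorted∈sublists (x ∷ xs) {k ∷ ks} (x< ∷ sxs) (k< ∷ sks) (here refl ∷ ks∈) =
    ∈-++⁺ˡ (∈-map⁺ (x ∷_) (sorted∈sublists xs sxs sks (All.zipWith drop (k< , ks∈))))
    where
    drop : ∀ {l} → (x Fin.< l × l ∈ x ∷ xs) → l ∈ xs
    drop (lt , here refl) = ⊥-elim (<-irrefl refl lt)
    drop (lt , there l∈) = l∈
  sorted∈sublists (x ∷ xs) {k ∷ ks} (x< ∷ sxs) (k< ∷ sks) (there k∈ ∷ ks∈) =
    ∈-++⁺ʳ (map (x ∷_) (sublists xs)) (sorted∈sublists xs sxs (k< ∷ sks) (k∈ ∷ All.zipWith drop (k< , ks∈)))
    where
    drop : ∀ {l} → (k Fin.< l × l ∈ x ∷ xs) → l ∈ xs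
    drop (lt , here refl) = ⊥-elim (<-irrefl refl (<-trans lt (All.lookup x< k∈)))
    drop (lt , there l∈) = l∈

  ∈-sublists⁻ : ∀ (xs : List (Fin t)) {ks z} → ks ∈ sublists xs → z ∈ ks → z ∈ xs
  ∈-sublists⁻ [] {_} (here refl) ()
  ∈-sublists⁻ (x ∷ xs) ks∈ z∈ with ∈-++⁻ (map (x ∷_) (sublists xs)) ks∈
  ... | inj₂ q = there (∈-sublists⁻ xs q z∈)
  ... | inj₁ p with ∈-map⁻ (x ∷_) p
  ...   | ks′ , ks′∈ , refl with z∈
  ...     | here refl = here refl
  ...     | there z∈′ = there (∈-sublists⁻ xs ks′∈ z∈′)

  sublists-unique : ∀ {xs : List (Fin t)} → Unique xs → Unique (sublists xs)
  sublists-unique {[]} _ = [] ∷ []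
  sublists-unique {x ∷ xs} (x∉ ∷ uxs) =
    Uniqueₚ.++⁺ (Uniqueₚ.map⁺ ∷-injectiveʳ (sublists-unique uxs)) (sublists-unique uxs) disjoint
    where
    disjoint : ∀ {ks} → ¬ (ks ∈ map (x ∷_) (sublists xs) × ks ∈ sublists xs)
    disjoint (p , q) with ∈-map⁻ (x ∷_) p
    ... | ks′ , _ , refl = All.lookup x∉ (∈-sublists⁻ xs q (here refl)) refl

  ¬reach⇒0 : ∀ {i j} → ¬ Reach i j → pathMatrix i j ≡ 0
  ¬reach⇒0 {i} {j} ¬r = empty (filterᵇ (λ ks → valid (src i) ks j) (sublists stages)) λ {ks} ks∈ →
    ¬r (ks , proj₂ (∈-filter⁻ (T? ∘ λ ks → valid (src i) ks j) {xs = sublists stages} ks∈))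
    where
    empty : ∀ {A : Set} (xs : List A) → (∀ {x} → ¬ x ∈ xs) → length xs ≡ 0
    empty [] _ = refl
    empty (x ∷ xs) h = ⊥-elim (h (here refl))

  reach? : ∀ i j → Dec (Reach i j)
  reach? i j with Any.any? (λ ks → T? (valid (src i) ks j)) (sublists stages)
  ... | yes p = yes (satisfied p)
  ... | no ¬p = no λ { (ks , h) → ¬p
      (Any.map (λ { refl → h }) (sorted∈sublists stages (AllPairsₚ.tabulate⁺-< id) (path-sorted ks h)
      (All.tabulate λ {k} _ → ∈-allFin k))) }

  -- Consequences of the zig-zag conditions for paths

  module _ (zz : ZigZag I) where
    private
      nonnest : ∀ {a b} → a ≢ b → ¬ (c I b Fin.≤ c I a × d I a Fin.≤ d I b)
      nonnest {a} {b} = proj₁ (proj₂ zz) a b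

    c-injective : ∀ {a b} → c I a ≡ c I b → a ≡ b
    c-injective {a} {b} e with a ≟ b
    ... | yes p = p
    ... | no a≢b with ≤-total (toℕ (d I a)) (toℕ (d I b))
    ...   | inj₁ le = ⊥-elim (nonnest a≢b (≤-reflexive (cong toℕ (sym e)) , le))
    ...   | inj₂ ge = ⊥-elim (nonnest (a≢b ∘ sym) (≤-reflexive (cong toℕ e) , ge))

    d-mono : ∀ {a b} → c I a Fin.< c I b → d I a Fin.< d I b
    d-mono {a} {b} lt = ≰⇒> λ le → nonnest (λ { refl → <-irrefl refl lt }) (<⇒≤ lt , le)

    overlaps : ∀ {a b x} → Cut a x → Cut b x → Overlap I a b
    overlaps (_ , p , q) (_ , r , s) = ≤-trans p s , ≤-trans r q

    turn : ∀ {i j k} → i Fin.< j → j Fin.< k → Overlap I i j → Overlap I j k →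
      (c I i Fin.< c I j × c I j Fin.< c I k) ⊎ (c I k Fin.< c I j × c I j Fin.< c I i)
    turn {i} {j} {k} = proj₂ (proj₂ zz) i j k

    Next⇒c≢ : ∀ {a b} → Next a b → c I a ≢ c I b
    Next⇒c≢ (a<b , _) e = <-irrefl (cong toℕ (c-injective e)) a<b

    third : ∀ {a b b′ x} → a Fin.< b′ → Cut a x → Cut b′ x → (∀ k → a Fin.< k → k Fin.< b′ → ¬ Cut k x) →
      a Fin.< b → Cut b x → b ≢ b′ →
      (c I a Fin.< c I b′ × c I b′ Fin.< c I b) ⊎ (c I b Fin.< c I b′ × c I b′ Fin.< c I a)
    third {b = b} {b′} a<b′ ca cb′ none a<b cb b≢b′ with <-cmp b b′
    ... | tri< b<b′ _ _ = ⊥-elim (none _ a<b b<b′ cb)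
    ... | tri≈ _ e _ = ⊥-elim (b≢b′ e)
    ... | tri> _ _ b′<b = turn a<b′ b′<b (overlaps ca cb′) (overlaps cb′ cb)

    -- The wire `x` from `a` to `b′` would also run through `b`, because
    -- `c I b < c I b′ ≤ x ≤ d I a < d I b`. By `third` the stages come in the order `a`, `b′`, `b`,
    -- and their left end points rise and then fall, which the zig-zag condition forbids.
    next-up-≮ : ∀ {a b b′} → Next a b → Next a b′ → c I a Fin.< c I b → c I a Fin.< c I b′ →
        ¬ (c I b Fin.< c I b′)
    next-up-≮ {a} {b} {b′} (a<b , _ , _ , (c<d , _) , _) (a<b′ , x , ca , cb′ , none) ab ab′ lt
      with third a<b′ ca cb′ none a<b
          (c<d , ≤-trans (<⇒≤ lt) (proj₁ (proj₂ cb′)) , ≤-trans (proj₂ (proj₂ ca)) (<⇒≤ (d-mono ab)))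
             (λ { refl → <-irrefl refl lt })
    ... | inj₁ (_ , gt) = <-asym lt gt
    ... | inj₂ (_ , gt) = <-asym ab′ gt

    next-down-≮ : ∀ {a b b′} → Next a b → Next a b′ → c I b Fin.< c I a → c I b′ Fin.< c I a →
        ¬ (c I b′ Fin.< c I b)
    next-down-≮ {a} {b} {b′} (a<b , _ , _ , (c<d , _) , _) (a<b′ , x , ca , cb′ , none) ba b′a lt
      with third a<b′ ca cb′ none a<b
          (c<d , ≤-trans (<⇒≤ ba) (proj₁ (proj₂ ca)) , ≤-trans (proj₂ (proj₂ cb′)) (<⇒≤ (d-mono lt)))
             (λ { refl → <-irrefl refl lt })
    ... | inj₁ (gt , _) = <-asym b′a gt
    ... | inj₂ (gt , _) = <-asym lt gt

    next-up-unique : ∀ {a b b′} → Next a b → Next a b′ → c I a Fin.< c I b → c I a Fin.< c I b′ → b ≡ b′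
    next-up-unique {b = b} {b′} p q ab ab′ with <-cmp (c I b) (c I b′)
    ... | tri< lt _ _ = ⊥-elim (next-up-≮ p q ab ab′ lt)
    ... | tri≈ _ e _ = c-injective e
    ... | tri> _ _ gt = ⊥-elim (next-up-≮ q p ab′ ab gt)

    next-down-unique : ∀ {a b b′} → Next a b → Next a b′ → c I b Fin.< c I a → c I b′ Fin.< c I a → b ≡ b′
    next-down-unique {b = b} {b′} p q ba b′a with <-cmp (c I b) (c I b′)
    ... | tri< lt _ _ = ⊥-elim (next-down-≮ q p b′a ba lt)
    ... | tri≈ _ e _ = c-injective e
    ... | tri> _ _ gt = ⊥-elim (next-down-≮ p q ba b′a gt)

    Up Down : Fin t → Idx n → Set
    Up a j = ∃ λ k → a Fin.< k × c I a Fin.< c I k × Last k j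
    Down a j = ∃ λ k → a Fin.< k × c I k Fin.< c I a × Last k j

    path-up : ∀ {a b} ks {j} → Next a b → c I a Fin.< c I b → Path (mid b) ks j → Up a j
    path-up {a} {b} [] nx ab h = b , proj₁ nx , ab , edge-mid-snk⁻ {b} h
    path-up {a} {b} (k ∷ ks) nx@(a<b , _ , ca , cb , _) ab h with uncons {mid b} {k} {ks} h
    ... | e , h′ with edge-mid-mid⁻ {b} {k} e
    ...   | nx′@(b<k , _ , cb′ , ck , _) with turn a<b b<k (overlaps ca cb) (overlaps cb′ ck)
    ...     | inj₂ (_ , gt) = ⊥-elim (<-asym ab gt)
    ...     | inj₁ (_ , bk) with path-up ks nx′ bk h′
    ...       | l , b<l , bl , la = l , <-trans a<b b<l , <-trans ab bl , la

    path-down : ∀ {a b} ks {j} → Next a b → c I b Fin.< c I a → Path (mid b) ks j → Down a j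
    path-down {a} {b} [] nx ba h = b , proj₁ nx , ba , edge-mid-snk⁻ {b} h
    path-down {a} {b} (k ∷ ks) nx@(a<b , _ , ca , cb , _) ba h with uncons {mid b} {k} {ks} h
    ... | e , h′ with edge-mid-mid⁻ {b} {k} e
    ...   | nx′@(b<k , _ , cb′ , ck , _) with turn a<b b<k (overlaps ca cb) (overlaps cb′ ck)
    ...     | inj₁ (gt , _) = ⊥-elim (<-asym ba gt)
    ...     | inj₂ (kb , _) with path-down ks nx′ kb h′
    ...       | l , b<l , lb , la = l , <-trans a<b b<l , <-trans lb ba , la

    -- The direction in which a path leaves `a`, stored with what this says about the sink. By
    -- monotonicity the direction of the first move persists to the last vertex.
    data Exit (a : Fin t) : List (Fin t) → Idx n → Set where
      level : ∀ {j} → Last a j → Exit a [] j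
      up    : ∀ {b ks j} → Next a b → c I a Fin.< c I b → Up a j → Exit a (b ∷ ks) j
      down  : ∀ {b ks j} → Next a b → c I b Fin.< c I a → Down a j → Exit a (b ∷ ks) j

    exit : ∀ {a} ks {j} → Path (mid a) ks j → Exit a ks j
    exit {a} [] h = level (edge-mid-snk⁻ {a} h)
    exit {a} (b ∷ ks) h with uncons {mid a} {b} {ks} h
    ... | e , h′ with edge-mid-mid⁻ {a} {b} e
    ...   | nx with <-cmp (c I a) (c I b)
    ...     | tri< lt _ _ = up nx lt (path-up ks nx lt h′)
    ...     | tri≈ _ eq _ = ⊥-elim (Next⇒c≢ nx eq)
    ...     | tri> _ _ gt = down nx gt (path-down ks nx gt h′)

    -- Otherwise the later vertex `k` that leads to `A` would also cut the wire `B`, squeezed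
    -- between `A` and `d I a < d I k`, although `a` is the last vertex on it.
    level<up : ∀ {a A B} → Last a B → Up a A → B Fin.< A
    level<up ((_ , _ , B≤d) , none) (k , a<k , ak , ((c<d , c≤A , _) , _)) = ≰⇒> λ A≤B →
      none k a<k (c<d , ≤-trans c≤A A≤B , ≤-trans B≤d (<⇒≤ (d-mono ak)))

    down<level : ∀ {a A B} → Down a B → Last a A → B Fin.< A
    down<level (l , a<l , la , ((c<d , _ , B≤d) , _)) ((_ , c≤A , _) , none) = ≰⇒> λ A≤B →
      none l a<l (c<d , ≤-trans (<⇒≤ la) c≤A , ≤-trans A≤B B≤d)

    -- Otherwise the intervals of `a`, `k` and `l` would overlap pairwise. But `a` is the earliest
    -- of the three stages while its left end point lies between the other two, so neither order of
    -- `k` and `l` is a zig-zag.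
    down<up : ∀ {a A B} → Down a B → Up a A → B Fin.< A
    down<up {a} {A} {B} (l , a<l , la , ((_ , cl≤B , B≤dl) , _)) (k , a<k , ak , ((_ , ck≤A , A≤dk) , _)) =
        ≰⇒> λ A≤B → contra A≤B (<-cmp k l)
      where
      contra : A Fin.≤ B → _ → ⊥
      contra A≤B = cases
        where
        ck≤dl : c I k Fin.≤ d I l
        ck≤dl = ≤-trans ck≤A (≤-trans A≤B B≤dl)
        okl : Overlap I k l
        okl = ck≤dl , ≤-trans (<⇒≤ (<-trans la ak)) (≤-trans ck≤A A≤dk)
        oak : Overlap I a k
        oak = ≤-trans (<⇒≤ ak) (≤-trans ck≤A A≤dk) , ≤-trans ck≤dl (<⇒≤ (d-mono la))
        oal : Overlap I a l
        oal = ≤-trans (<⇒≤ ak) ck≤dl , ≤-trans (≤-trans cl≤B B≤dl) (<⇒≤ (d-mono la))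
        case₁ : _ → ⊥
        case₁ (inj₁ (_ , kl)) = <-asym (<-trans la ak) kl
        case₁ (inj₂ (_ , ka)) = <-asym ak ka
        case₂ : _ → ⊥
        case₂ (inj₁ (al , _)) = <-asym la al
        case₂ (inj₂ (kl , _)) = <-asym (<-trans la ak) kl
        cases : _ → ⊥
        cases (tri≈ _ refl _) = <-asym la ak
        cases (tri< k<l _ _) = case₁ (turn a<k k<l oak okl)
        cases (tri> _ _ l<k) = case₂ (turn a<l l<k oal (proj₂ okl , proj₁ okl))

    -- The sinks below, level with and above `a` are disjoint ranges, so the sink fixes the
    -- direction of exit; in each direction there is only one possible next vertex.
    path-unique-mid : ∀ {a} ks ks′ {j} → Path (mid a) ks j → Path (mid a) ks′ j → ks ≡ ks′
    path-unique-mid {a} ks ks′ h h′ = go ks ks′ h h′ (exit ks h) (exit ks′ h′)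
      where
      go : ∀ {a} ks ks′ {j} → Path (mid a) ks j → Path (mid a) ks′ j → Exit a ks j → Exit a ks′ j → ks ≡ ks′
      go _ _ _ _ (level _) (level _) = refl
      go _ _ _ _ (level p) (up _ _ q) = ⊥-elim (<-irrefl refl (level<up p q))
      go _ _ _ _ (level p) (down _ _ q) = ⊥-elim (<-irrefl refl (down<level q p))
      go _ _ _ _ (up _ _ q) (level p) = ⊥-elim (<-irrefl refl (level<up p q))
      go _ _ _ _ (down _ _ q) (level p) = ⊥-elim (<-irrefl refl (down<level q p))
      go _ _ _ _ (up _ _ q) (down _ _ p) = ⊥-elim (<-irrefl refl (down<up p q))
      go _ _ _ _ (down _ _ p) (up _ _ q) = ⊥-elim (<-irrefl refl (down<up p q))
      go {a} (b ∷ ks) (b′ ∷ ks′) h h′ (up nx lt _) (up nx′ lt′ _) with next-up-unique nx nx′ lt lt′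
      ... | refl = cong (b ∷_) (path-unique-mid ks ks′ (proj₂ (uncons {mid a} {b} {ks} h))
          (proj₂ (uncons {mid a} {b} {ks′} h′)))
      go {a} (b ∷ ks) (b′ ∷ ks′) h h′ (down nx lt _) (down nx′ lt′ _) with next-down-unique nx nx′ lt lt′
      ... | refl = cong (b ∷_) (path-unique-mid ks ks′ (proj₂ (uncons {mid a} {b} {ks} h))
          (proj₂ (uncons {mid a} {b} {ks′} h′)))

    first-unique : ∀ {i k l} → First i k → First i l → k ≡ l
    first-unique {k = k} {l} (ck , nk) (cl , nl) with <-cmp k l
    ... | tri< lt _ _ = ⊥-elim (nl k lt ck)
    ... | tri≈ _ e _ = e
    ... | tri> _ _ gt = ⊥-elim (nk l gt cl)

    path-unique : ∀ {i} ks ks′ {j} → Path (src i) ks j → Path (src i) ks′ j → ks ≡ ks′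
    path-unique [] [] _ _ = refl
    path-unique {i} [] (k ∷ ks) {j} h h′ = ⊥-elim
        (proj₂ (edge-src-snk⁻ {i} {j} h) k (proj₁ (edge-src-mid⁻ {i} {k} (proj₁ (uncons {src i} {k} {ks} h′)))))
    path-unique {i} (k ∷ ks) [] {j} h h′ = ⊥-elim
        (proj₂ (edge-src-snk⁻ {i} {j} h′) k (proj₁ (edge-src-mid⁻ {i} {k} (proj₁ (uncons {src i} {k} {ks} h)))))
    path-unique {i} (k ∷ ks) (l ∷ ks′) h h′ with uncons {src i} {k} {ks} h | uncons {src i} {l} {ks′} h′
    ... | e , p | e′ , p′ with first-unique (edge-src-mid⁻ {i} {k} e) (edge-src-mid⁻ {i} {l} e′)
    ...   | refl = cong (k ∷_) (path-unique-mid ks ks′ p p′)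

    reach⇒1 : ∀ {i j} → Reach i j → pathMatrix i j ≡ 1
    reach⇒1 {i} {j} (ks , h) = count-≡1 (sublists-unique (Uniqueₚ.allFin⁺ t))
        (λ {ks} {ks′} → path-unique ks ks′)
      (sorted∈sublists stages (AllPairsₚ.tabulate⁺-< id) (path-sorted ks h)
          (All.tabulate λ {k} _ → ∈-allFin k)) h

    -- If `b` is up from `z`, then `B` is in the upper range and `A`, being larger, is as well, so
    -- `s₁` also begins with `b`. If `b` is down, either `s₁` goes down through `b` too, or `A` lies
    -- in a higher range than `j`.
    follow-< : ∀ {z b} ks s₁ s₂ {j A B} → Path (mid z) (b ∷ ks) j → Path (mid z) s₁ A →
        Path (mid z) (b ∷ s₂) B →
      B Fin.< A → j Fin.< A ⊎ (∃ λ s → s₁ ≡ b ∷ s)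
    follow-< {b = b} ks s₁ s₂ h h₁ h₂ B<A with exit (b ∷ ks) h | exit s₁ h₁ | exit (b ∷ s₂) h₂
    ... | up _ _ _ | level p | up _ _ q = ⊥-elim (<-asym B<A (level<up p q))
    ... | up _ _ _ | down _ _ p | up _ _ q = ⊥-elim (<-asym B<A (down<up p q))
    ... | up nx lt _ | up nx′ lt′ _ | up _ _ _ = inj₂ (_ , cong (_∷ _) (next-up-unique nx′ nx lt′ lt))
    ... | up _ lt _ | _ | down _ gt _ = ⊥-elim (<-asym lt gt)
    ... | down _ _ q | level p | _ = inj₁ (down<level q p)
    ... | down _ _ q | up _ _ p | _ = inj₁ (down<up q p)
    ... | down nx lt _ | down nx′ lt′ _ | _ = inj₂ (_ , cong (_∷ _) (next-down-unique nx′ nx lt′ lt))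

    follow-> : ∀ {z b} ks s₁ s₂ {j A B} → Path (mid z) (b ∷ ks) j → Path (mid z) s₁ A →
        Path (mid z) (b ∷ s₂) B →
      A Fin.< B → A Fin.< j ⊎ (∃ λ s → s₁ ≡ b ∷ s)
    follow-> {b = b} ks s₁ s₂ h h₁ h₂ A<B with exit (b ∷ ks) h | exit s₁ h₁ | exit (b ∷ s₂) h₂
    ... | down _ _ _ | level p | down _ _ q = ⊥-elim (<-asym A<B (down<level q p))
    ... | down _ _ _ | up _ _ p | down _ _ q = ⊥-elim (<-asym A<B (down<up q p))
    ... | down nx lt _ | down nx′ lt′ _ | down _ _ _ = inj₂ (_ , cong (_∷ _) (next-down-unique nx′ nx lt′ lt))
    ... | down _ lt _ | _ | up _ gt _ = ⊥-elim (<-asym lt gt)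
    ... | up _ _ q | level p | _ = inj₁ (level<up p q)
    ... | up _ _ q | down _ _ p | _ = inj₁ (down<up p q)
    ... | up nx lt _ | up nx′ lt′ _ | _ = inj₂ (_ , cong (_∷ _) (next-up-unique nx′ nx lt′ lt))

  -- The covering family of maximal type

  path-split : ∀ {v} p {z s j} → Path v (p ++ z ∷ s) j →
    Path (mid z) s j × (∀ {s′ j′} → Path (mid z) s′ j′ → Path v (p ++ z ∷ s′) j′)
  path-split {v} [] {z} {s} h with uncons {v} {z} {s} h
  ... | e , h′ = h′ , λ h″ → T∧⁺ e h″
  path-split {v} (k ∷ p) {z} {s} h with uncons {v} {k} {p ++ z ∷ s} h
  ... | e , h′ with path-split p h′
  ...   | q , r = q , λ h″ → T∧⁺ e (r h″)

  steps : Vtx n t → List (Fin t) → Fin t → List (Vtx n t × Vtx n t)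
  steps v [] z = [ (v , mid z) ]
  steps v (k ∷ p) z = (v , mid k) ∷ steps (mid k) p z

  edges : Vtx n t → List (Fin t) → Idx n → List (Vtx n t × Vtx n t)
  edges v ks j = consecutive (vseq v ks j)

  edges-++ : ∀ v p {z s j} → edges v (p ++ z ∷ s) j ≡ steps v p z ++ edges (mid z) s j
  edges-++ v [] = refl
  edges-++ v (k ∷ p) = cong ((v , mid k) ∷_) (edges-++ (mid k) p)

  snk-edge : ∀ {v z y j} ks → (mid z , snk y) ∈ edges v ks j → (v ≡ mid z ⊎ z ∈ ks) × y ≡ j
  snk-edge [] (here refl) = inj₁ refl , refl
  snk-edge (k ∷ ks) (there h) with snk-edge ks h
  ... | inj₁ refl , e = inj₂ (here refl) , e
  ... | inj₂ z∈ , e = inj₂ (there z∈) , e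

  mid-edge : ∀ {v z b j} ks → (mid z , mid b) ∈ edges v ks j →
    (v ≡ mid z × (∃ λ s → ks ≡ b ∷ s)) ⊎ (∃ λ p → ∃ λ s → ks ≡ p ++ z ∷ b ∷ s)
  mid-edge [] (here ())
  mid-edge [] (there ())
  mid-edge (k ∷ ks) (here refl) = inj₁ (refl , ks , refl)
  mid-edge (k ∷ ks) (there h) with mid-edge ks h
  ... | inj₁ (refl , s , refl) = inj₂ ([] , s , refl)
  ... | inj₂ (p , s , refl) = inj₂ (k ∷ p , s , refl)

  module Maximal (zz : ZigZag I) (w : Elt n) (max : IsMaxCoveringType I w) where
    π : Idx n → List (Fin t)
    π = proj₁ (proj₂ (proj₁ max))

    π-path : ∀ i → Path (src i) (π i) (w ⟨ i ⟩)
    π-path = proj₁ (proj₂ (proj₂ (proj₁ max)))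

    covers : ∀ {a b} → T (edge a b) → ∃ λ i → (a , b) ∈ edges (src i) (π i) (w ⟨ i ⟩)
    covers = proj₂ (proj₂ (proj₂ (proj₁ max))) _ _

    w-injective : Inj w
    w-injective = perm⁻ w (proj₁ (proj₁ max))

    -- Exchanging the tails of two non-inverted paths after a common vertex covers the same edges
    -- and creates an inversion.
    meet⇒≮ : ∀ {i m z} → i Fin.< m → z ∈ π i → z ∈ π m → ¬ (w ⟨ i ⟩ Fin.< w ⟨ m ⟩)
    meet⇒≮ {i} {m} {z} i<m z∈i z∈m wi<wm with ∈-∃++ z∈i | ∈-∃++ z∈m
    ... | p₁ , s₁ , e₁ | p₂ , s₂ , e₂ =
      <-irrefl refl (<-≤-trans (SwapInversions.invA-swap w i<m wi<wm)
          (proj₂ max u (perm⁺ u u-inj , π′ , valid′ , covers′)))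
      where
      i≢m : i ≢ m
      i≢m e = <-irrefl (cong toℕ e) i<m
      u : Elt n
      u = w · swapE i m
      u-inj : Inj u
      u-inj {a} {b} e = swap-inj (w-injective
          (trans (sym (·-⟨⟩ w (swapE i m) a)) (trans e (·-⟨⟩ w (swapE i m) b))))
        where
        swap-inv : ∀ k → swapE {n} i m ⟨ swapE {n} i m ⟨ k ⟩ ⟩ ≡ k
        swap-inv = swapE-involutive {n} i m
        swap-inj : swapE {n} i m ⟨ a ⟩ ≡ swapE {n} i m ⟨ b ⟩ → a ≡ b
        swap-inj e = trans (sym (swap-inv a)) (trans (cong (swapE {n} i m ⟨_⟩) e) (swap-inv b))
      ui : u ⟨ i ⟩ ≡ w ⟨ m ⟩
      ui = trans (·-⟨⟩ w (swapE i m) i) (cong (w ⟨_⟩) (swapE-left {n} i m))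
      um : u ⟨ m ⟩ ≡ w ⟨ i ⟩
      um = trans (·-⟨⟩ w (swapE i m) m) (cong (w ⟨_⟩) (swapE-right {n} i m))
      u-other : ∀ {k} → k ≢ i → k ≢ m → u ⟨ k ⟩ ≡ w ⟨ k ⟩
      u-other {k} k≢i k≢m = trans (·-⟨⟩ w (swapE i m) k) (cong (w ⟨_⟩) (swapE-other {n} k≢i k≢m))
      pathᵢ : Path (src i) (p₁ ++ z ∷ s₁) (w ⟨ i ⟩)
      pathᵢ = subst (λ ks → Path (src i) ks (w ⟨ i ⟩)) e₁ (π-path i)
      pathₘ : Path (src m) (p₂ ++ z ∷ s₂) (w ⟨ m ⟩)
      pathₘ = subst (λ ks → Path (src m) ks (w ⟨ m ⟩)) e₂ (π-path m)

      -- The graph of the family with exchanged tails. Validity and covering are proved by cases on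
      -- it, instead of by evaluating again the comparisons of `k` with `i` and `m`.
      data Which : Idx n → List (Fin t) → Idx n → Set where
        is-i : Which i (p₁ ++ z ∷ s₂) (w ⟨ m ⟩)
        is-m : Which m (p₂ ++ z ∷ s₁) (w ⟨ i ⟩)
        rest : ∀ {k} → k ≢ i → k ≢ m → Which k (π k) (w ⟨ k ⟩)
      which : ∀ k → ∃ λ ks → Which k ks (u ⟨ k ⟩)
      which k with k ≟ i
      ... | yes refl = _ , subst (Which i _) (sym ui) is-i
      ... | no k≢i with k ≟ m
      ...   | yes refl = _ , subst (Which m _) (sym um) is-m
      ...   | no k≢m = _ , subst (Which k _) (sym (u-other k≢i k≢m)) (rest k≢i k≢m)
      π′ : Idx n → List (Fin t)
      π′ k = proj₁ (which k)
      which-path : ∀ {k ks j} → Which k ks j → Path (src k) ks j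
      which-path is-i = proj₂ (path-split p₁ pathᵢ) (proj₁ (path-split p₂ pathₘ))
      which-path is-m = proj₂ (path-split p₂ pathₘ) (proj₁ (path-split p₁ pathᵢ))
      which-path {k} (rest _ _) = π-path k
      valid′ : ∀ k → Path (src k) (π′ k) (u ⟨ k ⟩)
      valid′ k = which-path (proj₂ (which k))
      which-unique : ∀ {k ks ks′ j j′} → Which k ks j → Which k ks′ j′ → ks ≡ ks′ × j ≡ j′
      which-unique is-i q = go refl q
        where
        go : ∀ {k ks j} → k ≡ i → Which k ks j → p₁ ++ z ∷ s₂ ≡ ks × w ⟨ m ⟩ ≡ j
        go _ is-i = refl , refl
        go e is-m = ⊥-elim (i≢m (sym e))
        go e (rest k≢i _) = ⊥-elim (k≢i e)
      which-unique is-m q = go refl q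
        where
        go : ∀ {k ks j} → k ≡ m → Which k ks j → p₂ ++ z ∷ s₁ ≡ ks × w ⟨ i ⟩ ≡ j
        go e is-i = ⊥-elim (i≢m e)
        go _ is-m = refl , refl
        go e (rest _ k≢m) = ⊥-elim (k≢m e)
      which-unique (rest k≢i k≢m) is-i = ⊥-elim (k≢i refl)
      which-unique (rest k≢i k≢m) is-m = ⊥-elim (k≢m refl)
      which-unique (rest _ _) (rest _ _) = refl , refl
      via : ∀ {k ks j e} → Which k ks j → e ∈ edges (src k) ks j → ∃ λ i → e ∈ edges (src i) (π′ i) (u ⟨ i ⟩)
      via {k} {e = e} wh e∈ with which-unique wh (proj₂ (which k))
      ... | refl , refl = k , e∈
      covers′ : ∀ a b → T (edge a b) → ∃ λ i → (a , b) ∈ edges (src i) (π′ i) (u ⟨ i ⟩)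
      covers′ a b h with covers {a} {b} h
      ... | k , e∈ with k ≟ i
      ...   | yes refl = redirect (∈-++⁻ (steps (src i) p₁ z)
          (subst ((a , b) ∈_) (trans (cong (λ ks → edges (src i) ks (w ⟨ i ⟩)) e₁) (edges-++ (src i) p₁)) e∈))
        where
        redirect : _ → _
        redirect (inj₁ pre) = via is-i (subst ((a , b) ∈_) (sym (edges-++ (src i) p₁)) (∈-++⁺ˡ pre))
        redirect (inj₂ suf) = via is-m (subst ((a , b) ∈_) (sym (edges-++ (src m) p₂))
            (∈-++⁺ʳ (steps (src m) p₂ z) suf))
      ...   | no k≢i with k ≟ m
      ...     | yes refl = redirect (∈-++⁻ (steps (src m) p₂ z)
          (subst ((a , b) ∈_) (trans (cong (λ ks → edges (src m) ks (w ⟨ m ⟩)) e₂) (edges-++ (src m) p₂)) e∈))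
        where
        redirect : _ → _
        redirect (inj₁ pre) = via is-m (subst ((a , b) ∈_) (sym (edges-++ (src m) p₂)) (∈-++⁺ˡ pre))
        redirect (inj₂ suf) = via is-i (subst ((a , b) ∈_) (sym (edges-++ (src i) p₁))
            (∈-++⁺ʳ (steps (src i) p₁ z) suf))
      ...     | no k≢m = via (rest k≢i k≢m) e∈

    meet⇒inverted : ∀ {i m z} → i Fin.< m → z ∈ π i → z ∈ π m → w ⟨ m ⟩ Fin.< w ⟨ i ⟩
    meet⇒inverted {i} {m} i<m z∈i z∈m with <-cmp (w ⟨ i ⟩) (w ⟨ m ⟩)
    ... | tri< lt _ _ = ⊥-elim (meet⇒≮ i<m z∈i z∈m lt)
    ... | tri≈ _ e _ = ⊥-elim (<-irrefl (cong toℕ (w-injective e)) i<m)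
    ... | tri> _ _ gt = gt

    -- Follow a path from source i vertex by vertex, keeping a path of the covering family that starts weakly
    -- before i (for the order ≺) and either still runs along or already ends beyond it.
    module Envelope (_≺_ : Idx n → Idx n → Set) (_≺?_ : ∀ x y → Dec (x ≺ y))
      (≺-asym : ∀ {x y} → x ≺ y → ¬ (y ≺ x))
      (≼≺-trans : ∀ {x y z} → ¬ (y ≺ x) → y ≺ z → x ≺ z)
      (inverted : ∀ {i m z} → i ≺ m → z ∈ π i → z ∈ π m → (w ⟨ m ⟩) ≺ (w ⟨ i ⟩))
      (follow : ∀ {z b} ks s₁ s₂ {j A B} → Path (mid z) (b ∷ ks) j → Path (mid z) s₁ A → Path (mid z)
          (b ∷ s₂) B →
        B ≺ A → (j ≺ A) ⊎ (∃ λ s → s₁ ≡ b ∷ s)) where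

      ≺-irrefl : ∀ {x} → ¬ (x ≺ x)
      ≺-irrefl p = ≺-asym p p

      walk : ∀ {i i′ z} p s₁ → ¬ (i ≺ i′) → π i′ ≡ p ++ z ∷ s₁ → ∀ ks {j} → Path (mid z) ks j →
        ∃ λ i″ → ¬ (i ≺ i″) × ¬ ((w ⟨ i″ ⟩) ≺ j)
      -- The covering path `m` over the last edge ends at `j`. If it starts beyond `i`, it is
      -- inverted with the path from `i′` that it meets at `z`, so the latter ends beyond `j`.
      walk {i} {i′} {z} p s₁ i′≼i e [] {j} h with covers {mid z} {snk j} h
      ... | m , m∈ with snk-edge (π m) m∈
      ...   | inj₂ z∈ , refl with i ≺? m
      ...     | no ≮ = m , ≮ , ≺-irrefl
      ...     | yes i≺m = i′ , i′≼i , ≺-asym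
          (inverted (≼≺-trans i′≼i i≺m) (subst (z ∈_) (sym e) (∈-++⁺ʳ p (here refl))) z∈)
      walk {i} {i′} {z} p s₁ i′≼i e (b ∷ ks) {j} h with uncons {mid z} {b} {ks} h
      ... | ed , h′ with covers {mid z} {mid b} ed
      ...   | m , m∈ with mid-edge (π m) m∈
      ...     | inj₂ (p₂ , s₂ , e₂) with i ≺? m
      -- A covering path over the edge from `z` to `b` takes over when it starts weakly before `i`.
      -- Otherwise it is inverted with the current one, and `follow` tells whether the current one
      -- also uses the edge or already ends beyond `j`.
      ...       | no ≮ = walk (p₂ ++ [ z ]) s₂ ≮ (trans e₂ (sym (++-assoc p₂ [ z ] (b ∷ s₂)))) ks h′
      ...       | yes i≺m
                  with follow ks s₁ s₂ h
                         (proj₁ (path-split p (subst (λ l → Path (src i′) l (w ⟨ i′ ⟩)) e (π-path i′))))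
                         (proj₁ (path-split p₂ (subst (λ l → Path (src m) l (w ⟨ m ⟩)) e₂ (π-path m))))
                         (inverted (≼≺-trans i′≼i i≺m) (subst (z ∈_) (sym e) (∈-++⁺ʳ p (here refl)))
                             (subst (z ∈_) (sym e₂) (∈-++⁺ʳ p₂ (here refl))))
      ...         | inj₁ lt = i′ , i′≼i , ≺-asym lt
      ...         | inj₂ (s , refl) = walk (p ++ [ z ]) s i′≼i (trans e (sym (++-assoc p [ z ] (b ∷ s)))) ks h′

      envelope : ∀ {i j} → Reach i j → ∃ λ i′ → ¬ (i ≺ i′) × ¬ ((w ⟨ i′ ⟩) ≺ j)
      envelope {i} {j} ([] , h) with path-unique-[] (edge-src-snk⁻ {i} {j} h) (π i) (π-path i)
        where
        path-unique-[] : i ≡ j × (∀ k → ¬ Cut k i) → ∀ ks {y} → Path (src i) ks y → y ≡ j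
        path-unique-[] (refl , _) [] {y} h = sym (proj₁ (edge-src-snk⁻ {i} {y} h))
        path-unique-[] (_ , none) (k ∷ ks) h = ⊥-elim
            (none k (proj₁ (edge-src-mid⁻ {i} {k} (proj₁ (uncons {src i} {k} {ks} h)))))
      ... | refl = i , ≺-irrefl , ≺-irrefl
      envelope {i} {j} (k ∷ ks , h) with π i in eq | π-path i
      ... | [] | h₀ = ⊥-elim (proj₂ (edge-src-snk⁻ {i} h₀) k
          (proj₁ (edge-src-mid⁻ {i} {k} (proj₁ (uncons {src i} {k} {ks} h)))))
      ... | l ∷ ls | h₀ with first-unique zz (edge-src-mid⁻ {i} {k} (proj₁ (uncons {src i} {k} {ks} h)))
          (edge-src-mid⁻ {i} {l} (proj₁ (uncons {src i} {l} {ls} h₀)))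
      ...   | refl = walk [] ls ≺-irrefl eq ks (proj₂ (uncons {src i} {k} {ks} h))

    reach⇒upper : ∀ {i j} → Reach i j → ∃ λ p → p Fin.≤ i × j Fin.≤ w ⟨ p ⟩
    reach⇒upper r with Envelope.envelope Fin._<_ _<?_ <-asym (λ ≮ lt → ≤-<-trans (≮⇒≥ ≮) lt) meet⇒inverted
        (follow-< zz) r
    ... | p , ≮ , ≮′ = p , ≮⇒≥ ≮ , ≮⇒≥ ≮′

    reach⇒lower : ∀ {i j} → Reach i j → ∃ λ q → i Fin.≤ q × w ⟨ q ⟩ Fin.≤ j
    reach⇒lower r with Envelope.envelope Fin._>_ (flip _<?_) <-asym (λ ≯ gt → <-≤-trans gt (≮⇒≥ ≯))
        (λ i>m p q → meet⇒inverted i>m q p) (follow-> zz) r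
    ... | q , ≯ , ≯′ = q , ≮⇒≥ ≯ , ≮⇒≥ ≯′

-- The Bruhat interval below the maximal covering type

module _ {n : ℕ} {Q : Idx n → Idx n → Set} where

  -- Used with `Q` the hull when climbing towards `w`, and with `Q` reachability when descending
  -- from it.
  entries-· : {v t : Elt n} {x y : Idx n} → IsRefl t x y → Signed v → (∀ k → Q k (v ⟨ k ⟩)) →
    Q x (v ⟨ y ⟩) → Q y (v ⟨ x ⟩) → Q (opposite x) (opposite (v ⟨ y ⟩)) → Q (opposite y) (opposite (v ⟨ x ⟩)) →
    ∀ k → Q k ((v · t) ⟨ k ⟩)
  entries-· {v} {t} {x} {y} r v-signed all qx qy qx̄ qȳ k = go (place x y k)
    where
    moved : ∀ {k l z} → t ⟨ k ⟩ ≡ l → v ⟨ l ⟩ ≡ z → Q k z → Q k ((v · t) ⟨ k ⟩)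
    moved {k} e f = subst (Q k) (sym (trans (·-⟨⟩ v t k) (trans (cong (v ⟨_⟩) e) f)))
    go : ∀ {k} → Place x y k → Q k ((v · t) ⟨ k ⟩)
    go at-x = moved (IsRefl.to r) refl qx
    go at-y = moved (IsRefl.fro r) refl qy
    go at-x̄ = moved (IsRefl.bar-to r) (v-signed y) qx̄
    go at-ȳ = moved (IsRefl.bar-fro r) (v-signed x) qȳ
    go {k} (other a b c d) = moved (IsRefl.fixes r a b c d) refl (all k)

module Interval {n t : ℕ} (w : Elt n) (w-inj : Inj w) (w-signed : Signed w)
  (¬3412 : ¬ Contains3412 w) (¬4231 : ¬ Contains4231 w)
  (I : Intervals n t) (zz : ZigZag I) (max : IsMaxCoveringType I w) where

  open Net I
  open Maximal zz w max using (π; π-path; reach⇒upper; reach⇒lower)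
  open Hull {w = w ⟨_⟩} w-inj
    (λ {i} {j} {k} {l} p q r s t u → ¬3412 (i , j , k , l , p , q , r , s , t , u))
    (λ {i} {j} {k} {l} p q r s t u → ¬4231 (i , j , k , l , p , q , r , s , t , u))

  H-bar : ∀ {x y} → H x y → H (opposite x) (opposite y)
  H-bar ((p , p≤x , y≤wp) , (q , x≤q , wq≤y)) =
    (opposite q , opposite-≤ x≤q , subst (_ Fin.≤_) (sym (w-signed q)) (opposite-≤ wq≤y)) ,
    (opposite p , opposite-≤ p≤x , subst (Fin._≤ _) (sym (w-signed p)) (opposite-≤ y≤wp))

  -- As long as `v` differs from `w`, the pair from `hull-ascent` and its negative are exchanged
  -- together. This is one Bruhat step, it stays in the hull by `H-bar`, and it is a lexicographic
  -- increase, so the climb stops, which it can do only at `w`.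
  hull⇒≤B : ∀ v → Inj v → Signed v → (∀ k → H k (v ⟨ k ⟩)) → v ≤B w
  hull⇒≤B v = go v (lex-wf >-wellFounded (Elt.oneLine v))
    where
    go : ∀ (v : Elt n) → Acc (Lex-< _≡_ Fin._>_) (Elt.oneLine v) → Inj v → Signed v → (∀ k → H k (v ⟨ k ⟩)) →
        v ≤B w
    go v (acc rs) v-inj v-signed v∈H with any? (λ k → ¬? (v ⟨ k ⟩ ≟ w ⟨ k ⟩))
    ... | no same = subst (v ≤B_) (Elt-ext λ k → agree k (v ⟨ k ⟩ ≟ w ⟨ k ⟩)) ε
      where
      agree : ∀ k → Dec (v ⟨ k ⟩ ≡ w ⟨ k ⟩) → v ⟨ k ⟩ ≡ w ⟨ k ⟩
      agree k (yes e) = e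
      agree k (no ne) = ⊥-elim (same (k , ne))
    ... | yes (k , vk≢wk) with hull-ascent v-inj v∈H vk≢wk
    ...   | i , j , i<j , vi<vj , Hij , Hji with pair-reflection {n} i<j
    ...     | s , isr , r with first-change {v = v} r v-signed i<j vi<vj
    ...       | p , same , lt = ascent-step v-inj v-signed isr r i<j vi<vj ◅
                  go (v · s) (rs (lex-< _ _ p (λ k k<p → sym (same k k<p)) lt))
                     (·-refl-injective v r v-inj) (·-refl-signed v r v-signed)
                     (entries-· {Q = H} {v = v} r v-signed v∈H Hij Hji (H-bar Hij) (H-bar Hji))

  reach⇒≤B : ∀ v → Inj v → Signed v → (∀ k → Reach k (v ⟨ k ⟩)) → v ≤B w
  reach⇒≤B v v-inj v-signed r = hull⇒≤B v v-inj v-signed λ k → reach⇒upper (r k) , reach⇒lower (r k)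

  -- The upper element is inverted at the exchanged pair and at the negated pair. Reachability is
  -- not known to be invariant under negation, so paths are crossed once for each pair.
  step-reach : ∀ {u v : Elt n} → BruhatStep u v → (∀ k → Reach k (v ⟨ k ⟩)) → ∀ k → Reach k (u ⟨ k ⟩)
  step-reach {u} st reach with step-ascent st
  ... | s , x , y , r , refl , u-signed , x<y , ux<uy =
    subst (λ z → ∀ k → Reach k (z ⟨ k ⟩)) (·-refl-cancel {u = u} r)
      (entries-· {Q = Reach} {v = v} r (·-refl-signed u r u-signed) reach (proj₁ low) (proj₂ low)
        (subst (Reach _) (v-signed y) (proj₂ high)) (subst (Reach _) (v-signed x) (proj₁ high)))
    where
    v : Elt n
    v = u · s
    v-signed : Signed v
    v-signed = ·-refl-signed u r u-signed
    vx : v ⟨ x ⟩ ≡ u ⟨ y ⟩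
    vx = trans (·-⟨⟩ u s x) (cong (u ⟨_⟩) (IsRefl.to r))
    vy : v ⟨ y ⟩ ≡ u ⟨ x ⟩
    vy = trans (·-⟨⟩ u s y) (cong (u ⟨_⟩) (IsRefl.fro r))
    vy<vx : v ⟨ y ⟩ Fin.< v ⟨ x ⟩
    vy<vx = subst₂ Fin._<_ (sym vy) (sym vx) ux<uy
    low : Reach x (v ⟨ y ⟩) × Reach y (v ⟨ x ⟩)
    low = reach-crossing x<y vy<vx (reach x) (reach y)
    high : Reach (opposite y) (v ⟨ opposite x ⟩) × Reach (opposite x) (v ⟨ opposite y ⟩)
    high = reach-crossing (opposite-< x<y)
        (subst₂ Fin._<_ (sym (v-signed x)) (sym (v-signed y)) (opposite-< vy<vx))
             (reach (opposite y)) (reach (opposite x))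

  ≤B⇒reach : ∀ {v} → v ≤B w → ∀ k → Reach k (v ⟨ k ⟩)
  ≤B⇒reach ε k = π k , π-path k
  ≤B⇒reach (st ◅ rest) = step-reach st (≤B⇒reach rest)

-- Comparison of the two sums, coefficient by coefficient

module RingLemmas {c ℓ : Level} (R : CommutativeRing c ℓ) where
  open CommutativeRing R renaming (refl to ≈-refl; sym to ≈-sym; trans to ≈-trans)
  open RingOps R

  sumR-cong : ∀ {A : Set} {f g : A → Carrier} (xs : List A) → (∀ {x} → x ∈ xs → f x ≈ g x) →
    sumR (map f xs) ≈ sumR (map g xs)
  sumR-cong [] _ = ≈-refl
  sumR-cong (x ∷ xs) eq = +-cong (eq (here refl)) (sumR-cong xs (eq ∘ there))

  product-one : ∀ {A : Set} {f : A → Carrier} (xs : List A) → (∀ x → f x ≈ 1#) → foldr _*_ 1# (map f xs) ≈ 1#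
  product-one [] _ = ≈-refl
  product-one (x ∷ xs) eq = ≈-trans (*-cong (eq x) (product-one xs eq)) (*-identityˡ 1#)

  product-zero : ∀ {A : Set} {f : A → Carrier} {xs : List A} {x} → x ∈ xs → f x ≈ 0# →
      foldr _*_ 1# (map f xs) ≈ 0#
  product-zero (here refl) eq = ≈-trans (*-congʳ eq) (zeroˡ _)
  product-zero (there x∈) eq = ≈-trans (*-congˡ (product-zero x∈ eq)) (zeroʳ _)

  fromℕ-1 : fromℕ 1 ≈ 1#
  fromℕ-1 = CommutativeRing.+-identityʳ R 1#

theorem6p4 : ∀ {c ℓ : Level} (n : ℕ) (w : Elt n) →
    T (inBᵇ w) → ¬ Contains3412 w → ¬ Contains4231 w →
    (t : ℕ) (I : Intervals n t) → ZigZag I → IsMaxCoveringType I w →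
    (R : CommutativeRing c ℓ) (θ : Elt n → CommutativeRing.Carrier R) →
    (dec : ∀ v → Dec (v ≤B w)) →
    CommutativeRing._≈_ R (RingOps.thetaC' R θ w dec)
    (RingOps.immB R θ (Network.pathMatrix I))
theorem6p4 n w w∈B ¬3412 ¬4231 t I zz max R θ dec = sumR-cong (Bn n) term
  where
  open CommutativeRing R renaming (refl to ≈-refl; sym to ≈-sym; trans to ≈-trans)
  open RingOps R
  open RingLemmas R
  open Net I
  open Interval w (perm⁻ w (proj₁ (T∧⁻ {isPermᵇ w} w∈B)))
      (signed⁻ w (proj₂ (T∧⁻ {isPermᵇ w} w∈B))) ¬3412 ¬4231 I zz max
    using (reach⇒≤B; ≤B⇒reach)

  term : ∀ {v} → v ∈ Bn n → (if ⌊ dec v ⌋ then θ v else 0#) ≈ θ v * prodR (λ k → fromℕ (pathMatrix k (v ⟨ k ⟩)))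
  term {v} v∈ with dec v
  ... | yes v≤w = ≈-sym (≈-trans (*-congˡ (product-one (allFin _) λ k →
          ≈-trans (reflexive (cong fromℕ (reach⇒1 zz (≤B⇒reach v≤w k)))) fromℕ-1)) (*-identityʳ (θ v)))
  ... | no v≰w with any? (λ k → ¬? (reach? k (v ⟨ k ⟩)))
  ...   | yes (k , ¬r) = ≈-sym (≈-trans
      (*-congˡ (product-zero (∈-allFin k) (reflexive (cong fromℕ (¬reach⇒0 ¬r))))) (zeroʳ (θ v)))
  ...   | no none = ⊥-elim (v≰w (reach⇒≤B v (perm⁻ v (proj₁ v∈B)) (signed⁻ v (proj₂ v∈B)) λ k → reached k
      (reach? k (v ⟨ k ⟩))))
    where
    v∈B : T (isPermᵇ v) × T (isSignedᵇ v)
    v∈B = T∧⁻ {isPermᵇ v} (proj₂ (∈-filter⁻ (T? ∘ inBᵇ) {xs = map mkE (allVecs (allFin (M n)) (M n))} v∈))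
    reached : ∀ k → Dec (Reach k (v ⟨ k ⟩)) → Reach k (v ⟨ k ⟩)
    reached k (yes r) = r
    reached k (no ¬r) = ⊥-elim (none (k , ¬r))
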